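{- Let $G$ be a finite simple undirected graph with vertex set $V$, $|V|=n$, edge set $E$, $|E|=m\ge 1$, and vertex degrees $d_i$ ($i\in V$), and let $\mu$ be the largest eigenvalue of its adjacency matrix. Put $$\beta=\frac{\mu n}{2m},\qquad \epsilon=\frac{n\sum_{ij\in E}\sqrt{d_id_j}}{2m^2},\qquad R(G)=\sum_{ij\in E}\frac{1}{\sqrt{d_id_j}}.$$ Then $$\frac{m}{\mu}=\frac{n}{2\beta}\le\frac{n}{2\epsilon}\le R(G).$$
   Context: $R(G)$ is the Randić index of $G$. Sums over $ij\in E$ run over each (unordered) edge once. The quantities $\beta$ and $\epsilon$ are measures of irregularity of $G$, defined for graphs with at least one edge. -}

module Defs where

open import Level using (0ℓ; _⊔_) renaming (suc to lsuc)
open import Algebra.Apartness.Bundles using (HeytingField; HeytingCommutativeRing)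
import Algebra.Apartness.Properties.HeytingCommutativeRing as HeytingProperties
open import Algebra.Bundles using (CommutativeRing)
import Algebra.Definitions.RawMonoid as RawMonoidDefinitions
import Algebra.Properties.Ring as RingProperties
open import Data.Bool.Base using (if_then_else_)
open import Data.Empty using (⊥-elim)
open import Data.Fin.Base as Fin using (Fin)
import Data.Fin.Properties as Fin
open import Data.List.Base
  using (List; length; filter; foldr; allFin; cartesianProduct; mapMaybe)
open import Data.List.Membership.Propositional using (lose)
open import Data.List.Membership.Propositional.Properties using (∈-allFin)
open import Data.List.Properties using (filter-some)
open import Data.Maybe.Base using (Maybe; just; nothing)
open import Data.Nat.Base as ℕ using (ℕ; zero; suc)
import Data.Nat.Properties as ℕ
open import Data.Product.Base using (Σ-syntax; ∃-syntax; _×_; _,_; proj₁; proj₂)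
open import Data.Sum.Base using (_⊎_; inj₁; inj₂)
open import Data.Vec.Functional using (Vector)
open import Relation.Binary.Core using (Rel)
open import Relation.Binary.Definitions using (Decidable; Irreflexive; Symmetric)
open import Relation.Binary.PropositionalEquality.Core using (_≡_)
open import Relation.Binary.Structures using (IsStrictPartialOrder)
open import Relation.Nullary.Decidable.Core using (yes; no; does; _×-dec_)
open import Relation.Nullary.Negation.Core using (¬_)

-- The real numbers, given axiomatically as a Cauchy-complete Archimedean
-- ordered field. Classically these axioms determine ℝ up to isomorphism. The
-- order is not assumed to be decidable, so that the constructive reals are a
-- model too; accordingly x ≤ y means ¬ (y < x), and x # y (x < y or y < x)
-- plays the role of x ≠ y. The axiom √-exists is not independent of the
-- others: it is included so that square roots need not be constructed.

record RealNumbers c ℓ₁ ℓ₂ : Set (lsuc (c ⊔ ℓ₁ ⊔ ℓ₂)) where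
  infix 4 _<_ _≤_

  field
    heytingField : HeytingField c ℓ₁ ℓ₂

  open HeytingField heytingField public

  commutativeRing : CommutativeRing c ℓ₁
  commutativeRing = HeytingCommutativeRing.commutativeRing heytingCommutativeRing

  open RawMonoidDefinitions (CommutativeRing.+-rawMonoid commutativeRing) public
    using (sum) renaming (_×_ to _×ℕ_)

  fromℕ : ℕ → Carrier
  fromℕ k = k ×ℕ 1#

  field
    _<_                  : Rel Carrier ℓ₂
    isStrictPartialOrder : IsStrictPartialOrder _≈_ _<_
    #⇒<⊎>                : ∀ {x y} → x # y → x < y ⊎ y < x
    <⇒#                  : ∀ {x y} → x < y → x # y
    +-monoˡ-<            : ∀ z {x y} → x < y → x + z < y + z
    *-pos                : ∀ {x y} → 0# < x → 0# < y → 0# < x * y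
    archimedean          : ∀ x → ∃[ k ] x < fromℕ k

  _≤_ : Rel Carrier ℓ₂
  x ≤ y = ¬ (y < x)

  -- The condition on i and j is symmetric, so it bounds ∣ s i - s j ∣.
  IsCauchy : (ℕ → Carrier) → Set (c ⊔ ℓ₂)
  IsCauchy s = ∀ ε → 0# < ε →
    ∃[ N ] (∀ i j → N ℕ.≤ i → N ℕ.≤ j → s i < s j + ε)

  _ConvergesTo_ : (ℕ → Carrier) → Carrier → Set (c ⊔ ℓ₂)
  s ConvergesTo l = ∀ ε → 0# < ε →
    ∃[ N ] (∀ i → N ℕ.≤ i → s i < l + ε × l < s i + ε)

  field
    complete : ∀ s → IsCauchy s → ∃[ l ] s ConvergesTo l
    √-exists : ∀ x → 0# ≤ x → ∃[ y ] 0# ≤ y × y * y ≈ x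

module RealOperations {c ℓ₁ ℓ₂} (ℝ : RealNumbers c ℓ₁ ℓ₂) where
  open RealNumbers ℝ
  open HeytingProperties heytingCommutativeRing public
    using (1#0; x-0≈x; x#0y#0→xy#0; #-congʳ; invertibleʳ⇒#)
  open RingProperties (CommutativeRing.ring commutativeRing)
    using (-‿distribˡ-*; -‿involutive)
  private module < = IsStrictPartialOrder isStrictPartialOrder

  infixl 7 _/_⟨_⟩

  -- #⇒invertible yields the inverse of y - 0#, which is y.
  _/_⟨_⟩ : (x y : Carrier) → y # 0# → Carrier
  x / y ⟨ y#0 ⟩ = x * proj₁ (#⇒invertible y#0)

  0<1 : 0# < 1#
  0<1 with #⇒<⊎> 1#0
  ... | inj₂ 0<1 = 0<1
  ... | inj₁ 1<0 = ⊥-elim (<.irrefl refl (<.trans 1<0 0<1′))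
    where
    0<-1 : 0# < - 1#
    0<-1 = <.<-respˡ-≈ (-‿inverseʳ 1#)
      (<.<-respʳ-≈ (+-identityˡ (- 1#)) (+-monoˡ-< (- 1#) 1<0))
    0<1′ : 0# < 1#
    0<1′ = <.<-respʳ-≈
      (trans (sym (-‿distribˡ-* 1# (- 1#)))
        (trans (-‿cong (*-identityˡ (- 1#))) (-‿involutive 1#)))
      (*-pos 0<-1 0<-1)

  fromℕ-pos : ∀ {k} → 0 ℕ.< k → 0# < fromℕ k
  fromℕ-pos {suc zero}    _ = <.<-respʳ-≈ (sym (+-identityʳ 1#)) 0<1
  fromℕ-pos {suc (suc k)} _ = <.trans (fromℕ-pos {suc k} ℕ.z<s)
    (<.<-respˡ-≈ (+-identityˡ _) (+-monoˡ-< (fromℕ (suc k)) 0<1))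

  fromℕ-#0 : ∀ k → 0 ℕ.< k → fromℕ k # 0#
  fromℕ-#0 k 0<k = #-sym (<⇒# (fromℕ-pos 0<k))

  fromℕ-nonneg : ∀ k → 0# ≤ fromℕ k
  fromℕ-nonneg zero    0<0 = <.irrefl refl 0<0
  fromℕ-nonneg (suc k) k<0 = <.asym (fromℕ-pos {suc k} ℕ.z<s) k<0

  √ : ∀ x → 0# ≤ x → Carrier
  √ x 0≤x = proj₁ (√-exists x 0≤x)

  √ℕ : ℕ → Carrier
  √ℕ k = √ (fromℕ k) (fromℕ-nonneg k)

  √ℕ-#0 : ∀ k → 0 ℕ.< k → √ℕ k # 0#
  √ℕ-#0 k 0<k = invertibleʳ⇒# (y * k⁻¹ , y-inverse)
    where
    y    = √ℕ k
    y²≈k = proj₂ (proj₂ (√-exists (fromℕ k) (fromℕ-nonneg k)))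
    k⁻¹  = proj₁ (#⇒invertible (fromℕ-#0 k 0<k))
    y-inverse : (y - 0#) * (y * k⁻¹) ≈ 1#
    y-inverse =
      trans (*-congʳ (x-0≈x y))
      (trans (sym (*-assoc y y k⁻¹))
      (trans (*-congʳ (trans y²≈k (sym (x-0≈x (fromℕ k)))))
        (proj₂ (proj₂ (#⇒invertible (fromℕ-#0 k 0<k))))))

  Matrix : ℕ → Set c
  Matrix n = Fin n → Fin n → Carrier

  IsEigenvalue : ∀ {n} → Matrix n → Carrier → Set (c ⊔ ℓ₁ ⊔ ℓ₂)
  IsEigenvalue {n} A κ = Σ[ v ∈ Vector Carrier n ]
    (∃[ i ] v i # 0#) × (∀ i → sum (λ j → A i j * v j) ≈ κ * v i)

  IsLargestEigenvalue : ∀ {n} → Matrix n → Carrier → Set (c ⊔ ℓ₁ ⊔ ℓ₂)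
  IsLargestEigenvalue A μ = IsEigenvalue A μ × (∀ κ → IsEigenvalue A κ → κ ≤ μ)

record SimpleGraph (n : ℕ) : Set₁ where
  infix 4 _~_ _~?_
  field
    _~_      : Rel (Fin n) 0ℓ
    _~?_     : Decidable _~_
    ~-sym    : Symmetric _~_
    ~-irrefl : Irreflexive _≡_ _~_

  deg : Fin n → ℕ
  deg i = length (filter (i ~?_) (allFin n))

  -- Each unordered edge is represented once, by its endpoints in increasing order.
  record Edge : Set where
    constructor edge
    field
      {src tgt} : Fin n
      src<tgt   : src Fin.< tgt
      src~tgt   : src ~ tgt

  toEdge : Fin n × Fin n → Maybe Edge
  toEdge (i , j) with (i Fin.<? j) ×-dec (i ~? j)
  ... | yes (i<j , i~j) = just (edge i<j i~j)
  ... | no  _           = nothing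

  edges : List Edge
  edges = mapMaybe toEdge (cartesianProduct (allFin n) (allFin n))

  ∣E∣ : ℕ
  ∣E∣ = length edges

  deg-pos : ∀ {i j} → i ~ j → 0 ℕ.< deg i
  deg-pos {i} {j} i~j = filter-some (i ~?_) (lose (∈-allFin j) i~j)

  degProduct : Edge → ℕ
  degProduct e = deg (Edge.src e) ℕ.* deg (Edge.tgt e)

  degProduct-pos : ∀ e → 0 ℕ.< degProduct e
  degProduct-pos e =
    ℕ.*-mono-≤ (deg-pos (Edge.src~tgt e)) (deg-pos (~-sym (Edge.src~tgt e)))

module GraphInvariants {c ℓ₁ ℓ₂} (ℝ : RealNumbers c ℓ₁ ℓ₂)
                       {n} (G : SimpleGraph n) where
  open RealNumbers ℝ
  open RealOperations ℝ
  open SimpleGraph G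

  adjacencyMatrix : Matrix n
  adjacencyMatrix i j = if does (i ~? j) then 1# else 0#

  ∑E : (Edge → Carrier) → Carrier
  ∑E f = foldr (λ e s → f e + s) 0# edges

  randić : Carrier
  randić = ∑E λ e → 1# / √ℕ (degProduct e) ⟨ √ℕ-#0 (degProduct e) (degProduct-pos e) ⟩

  -- The parameter μ is meant to be the largest eigenvalue of adjacencyMatrix.
  β : 0 ℕ.< ∣E∣ → Carrier → Carrier
  β 0<m μ = (μ * fromℕ n) / (fromℕ 2 * m) ⟨ x#0y#0→xy#0 (fromℕ-#0 2 ℕ.z<s) (fromℕ-#0 ∣E∣ 0<m) ⟩
    where m = fromℕ ∣E∣

  ε : 0 ℕ.< ∣E∣ → Carrier
  ε 0<m = (fromℕ n * ∑E (λ e → √ℕ (degProduct e))) / (fromℕ 2 * (m * m))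
    ⟨ x#0y#0→xy#0 (fromℕ-#0 2 ℕ.z<s) (x#0y#0→xy#0 (fromℕ-#0 ∣E∣ 0<m) (fromℕ-#0 ∣E∣ 0<m)) ⟩
    where m = fromℕ ∣E∣

{-# OPTIONS --safe #-}
module Submission where

-- With x i = √(deg i) the handshake identity gives x ∙ x = 2m and x ∙ A x = 2 ∑ √(dᵢ dⱼ),
-- so ε ≤ β is the Rayleigh inequality x ∙ A x ≤ μ (x ∙ x), and the bound on R(G) is the
-- Cauchy–Schwarz inequality m² ≤ ∑ √(dᵢ dⱼ) · ∑ 1/√(dᵢ dⱼ).
--
-- The Rayleigh inequality asks for an eigenvalue κ with x ∙ A x ≤ κ (x ∙ x), in a
-- setting where suprema need an explicit rate of convergence. Put y k = x ∙ A^(2ᵏ) x and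
-- q = x ∙ x. Then y (k+1) ≤ (y k)² ≤ q y (k+1), so the roots of y k of order 2ᵏ converge
-- at the rate q^(1/2ᵏ) - 1 to some κ, with κ^(2ᵏ) ≤ y k ≤ q κ^(2ᵏ). If κ were no
-- eigenvalue, κ u = A u + x would have a solution u; iterating this equation makes
-- x ∙ (κ^N u - A^N u) a sum growing like k κ^(N-1) for N = 2ᵏ, while it is O(κ^N).
-- Eigenvectors are only shown not to fail to exist, which suffices as ≤ is negative.

open import Defs
open import Algebra.Bundles using (CommutativeRing)
import Algebra.Properties.Ring as RingProperties
import Algebra.Properties.Semiring.Sum as SemiringSum
import Algebra.Solver.Ring.NaturalCoefficients.Default as SemiringSolver
open import Data.Bool.Base using (true; false; if_then_else_)
open import Data.Empty using (⊥-elim)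
open import Data.Fin.Base as Fin using (Fin)
import Data.Fin.Properties as Fin
open import Data.List.Base as List
  using (List; []; _∷_; _++_; length; filter; foldr; allFin; tabulate; cartesianProduct; mapMaybe)
open import Data.Maybe.Base using (Maybe; just; nothing; maybe′)
open import Data.Nat.Base as ℕ using (ℕ; zero; suc)
import Data.Nat.Properties as ℕ
open import Data.Product.Base using (Σ-syntax; ∃-syntax; _×_; _,_; proj₁; proj₂)
open import Data.Sum.Base using (_⊎_; inj₁; inj₂; [_,_])
open import Data.Vec.Functional using (Vector) renaming (_∷_ to _∷ᵛ_)
open import Function.Base using (id; _∘_)
open import Level using (_⊔_)
open import Relation.Binary.Definitions using (Tri; tri<; tri≈; tri>)
open import Relation.Binary.PropositionalEquality.Core as ≡ using (_≡_)
import Relation.Binary.Reasoning.Base.Triple as TripleReasoning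
open import Relation.Binary.Structures using (IsPreorder; IsStrictPartialOrder)
open import Relation.Nullary.Decidable.Core using (Dec; yes; no; does; _×-dec_)
open import Relation.Nullary.Negation.Core using (¬_)
open import Relation.Unary using (Pred; Decidable)

-- Order and arithmetic of the reals, without deciding the order.

module OrderedField {c ℓ₁ ℓ₂} (ℝ : RealNumbers c ℓ₁ ℓ₂) where
  open RealNumbers ℝ
  open RealOperations ℝ
  open RingProperties (CommutativeRing.ring commutativeRing)
    using (-‿distribˡ-*; -‿distribʳ-*; -‿involutive)
  open CommutativeRing commutativeRing using (commutativeSemiring)
  open SemiringSolver commutativeSemiring
  module < = IsStrictPartialOrder isStrictPartialOrder

  -- Stands in for trichotomy. Cotransitivity of `#` separates `z` from one of the two ends, and
  -- either sign of that separation settles the choice.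
  <-cotrans : ∀ {x y} → x < y → ∀ z → x < z ⊎ z < y
  <-cotrans x<y z with #-cotrans (<⇒# x<y) z
  ... | inj₁ x#z with #⇒<⊎> x#z
  ...   | inj₁ x<z = inj₁ x<z
  ...   | inj₂ z<x = inj₂ (<.trans z<x x<y)
  <-cotrans x<y z | inj₂ z#y with #⇒<⊎> z#y
  ...   | inj₁ z<y = inj₂ z<y
  ...   | inj₂ y<z = inj₁ (<.trans x<y y<z)

  <⇒≤ : ∀ {x y} → x < y → x ≤ y
  <⇒≤ = <.asym

  ≤-reflexive : ∀ {x y} → x ≈ y → x ≤ y
  ≤-reflexive x≈y = <.irrefl (sym x≈y)

  ≤-refl : ∀ {x} → x ≤ x
  ≤-refl = ≤-reflexive refl

  ≤-trans : ∀ {x y z} → x ≤ y → y ≤ z → x ≤ z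
  ≤-trans {y = y} x≤y y≤z z<x with <-cotrans z<x y
  ... | inj₁ z<y = y≤z z<y
  ... | inj₂ y<x = x≤y y<x

  <-≤-trans : ∀ {x y z} → x < y → y ≤ z → x < z
  <-≤-trans {z = z} x<y y≤z with <-cotrans x<y z
  ... | inj₁ x<z = x<z
  ... | inj₂ z<y = ⊥-elim (y≤z z<y)

  ≤-<-trans : ∀ {x y z} → x ≤ y → y < z → x < z
  ≤-<-trans {x} x≤y y<z with <-cotrans y<z x
  ... | inj₁ y<x = ⊥-elim (x≤y y<x)
  ... | inj₂ x<z = x<z

  ≤-antisym : ∀ {x y} → x ≤ y → y ≤ x → x ≈ y
  ≤-antisym {x} {y} x≤y y≤x = proj₁ (tight x y) λ x#y → [ y≤x , x≤y ] (#⇒<⊎> x#y)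

  ≤-isPreorder : IsPreorder _≈_ _≤_
  ≤-isPreorder = record
    { isEquivalence = isEquivalence
    ; reflexive     = ≤-reflexive
    ; trans         = ≤-trans
    }

  module ≤-Reasoning = TripleReasoning ≤-isPreorder
    <.asym <.trans <.<-resp-≈ <⇒≤ <-≤-trans ≤-<-trans

  open ≤-Reasoning

  x+y-y≈x : ∀ x y → (x + y) - y ≈ x
  x+y-y≈x x y = trans (+-assoc x y (- y)) (trans (+-congˡ (-‿inverseʳ y)) (+-identityʳ x))

  x+[y-x]≈y : ∀ x y → x + (y - x) ≈ y
  x+[y-x]≈y x y = trans (sym (+-assoc x y (- x))) (trans (+-congʳ (+-comm x y)) (x+y-y≈x y x))

  +-cancelʳ-< : ∀ z {x y} → x + z < y + z → x < y
  +-cancelʳ-< z x+z<y+z =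
    <.<-respʳ-≈ (x+y-y≈x _ z) (<.<-respˡ-≈ (x+y-y≈x _ z) (+-monoˡ-< (- z) x+z<y+z))

  +-monoˡ-≤ : ∀ z {x y} → x ≤ y → x + z ≤ y + z
  +-monoˡ-≤ z x≤y = x≤y ∘ +-cancelʳ-< z

  +-mono-≤ : ∀ {w x y z} → w ≤ x → y ≤ z → w + y ≤ x + z
  +-mono-≤ {w} {x} {y} {z} w≤x y≤z = begin
    w + y ≤⟨ +-monoˡ-≤ y w≤x ⟩
    x + y ≈⟨ +-comm x y ⟩
    y + x ≤⟨ +-monoˡ-≤ x y≤z ⟩
    z + x ≈⟨ +-comm z x ⟩
    x + z ∎

  +-monoʳ-≤ : ∀ z {x y} → x ≤ y → z + x ≤ z + y
  +-monoʳ-≤ z = +-mono-≤ ≤-refl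

  +-monoʳ-< : ∀ z {x y} → x < y → z + x < z + y
  +-monoʳ-< z x<y = <.<-respʳ-≈ (+-comm _ z) (<.<-respˡ-≈ (+-comm _ z) (+-monoˡ-< z x<y))

  +-cancelʳ-≤ : ∀ z {x y} → x + z ≤ y + z → x ≤ y
  +-cancelʳ-≤ z x+z≤y+z y<x = x+z≤y+z (+-monoˡ-< z y<x)

  +-nonneg : ∀ {x y} → 0# ≤ x → 0# ≤ y → 0# ≤ x + y
  +-nonneg {x} {y} 0≤x 0≤y = begin
    0#      ≈⟨ +-identityʳ 0# ⟨
    0# + 0# ≤⟨ +-mono-≤ 0≤x 0≤y ⟩
    x + y   ∎

  x≤x+y : ∀ {x y} → 0# ≤ y → x ≤ x + y
  x≤x+y {x} {y} 0≤y = begin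
    x      ≈⟨ +-identityʳ x ⟨
    x + 0# ≤⟨ +-monoʳ-≤ x 0≤y ⟩
    x + y  ∎

  y≤x+y : ∀ {x y} → 0# ≤ x → y ≤ x + y
  y≤x+y {x} {y} 0≤x = ≤-trans (x≤x+y 0≤x) (≤-reflexive (+-comm y x))

  x<x+y : ∀ {x y} → 0# < y → x < x + y
  x<x+y {x} {y} 0<y = begin-strict
    x      ≈⟨ +-identityʳ x ⟨
    x + 0# <⟨ +-monoʳ-< x 0<y ⟩
    x + y  ∎

  x≤y⇒0≤y-x : ∀ {x y} → x ≤ y → 0# ≤ y - x
  x≤y⇒0≤y-x {x} {y} x≤y = begin
    0#    ≈⟨ -‿inverseʳ x ⟨
    x - x ≤⟨ +-monoˡ-≤ (- x) x≤y ⟩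
    y - x ∎

  x<y⇒0<y-x : ∀ {x y} → x < y → 0# < y - x
  x<y⇒0<y-x {x} {y} x<y = begin-strict
    0#    ≈⟨ -‿inverseʳ x ⟨
    x - x <⟨ +-monoˡ-< (- x) x<y ⟩
    y - x ∎

  -- If `z` inverts `x * y`, then `y * z` inverts `x`.
  *-#0ˡ : ∀ {x y} → x * y # 0# → x # 0#
  *-#0ˡ {x} {y} xy#0 = invertibleʳ⇒# (y * z , (begin-equality
    (x - 0#) * (y * z) ≈⟨ *-congʳ (x-0≈x x) ⟩
    x * (y * z)        ≈⟨ *-assoc x y z ⟨
    (x * y) * z        ≈⟨ *-congʳ (x-0≈x (x * y)) ⟨
    (x * y - 0#) * z   ≈⟨ proj₂ (proj₂ (#⇒invertible xy#0)) ⟩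
    1#                 ∎))
    where z = proj₁ (#⇒invertible xy#0)

  *-#0ʳ : ∀ {x y} → x * y # 0# → y # 0#
  *-#0ʳ {x} {y} xy#0 = *-#0ˡ (#-congʳ (*-comm x y) xy#0)

  0≤x∧x#0⇒0<x : ∀ {x} → 0# ≤ x → x # 0# → 0# < x
  0≤x∧x#0⇒0<x 0≤x x#0 with #⇒<⊎> x#0
  ... | inj₁ x<0 = ⊥-elim (0≤x x<0)
  ... | inj₂ 0<x = 0<x

  -- Refuting `x * y < 0#` is easier than a direct proof: it makes the product apart from zero,
  -- hence both factors, so nonnegative factors become positive.
  *-nonneg : ∀ {x y} → 0# ≤ x → 0# ≤ y → 0# ≤ x * y
  *-nonneg 0≤x 0≤y xy<0 = <.asym xy<0
    (*-pos (0≤x∧x#0⇒0<x 0≤x (*-#0ˡ xy#0)) (0≤x∧x#0⇒0<x 0≤y (*-#0ʳ xy#0)))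
    where xy#0 = <⇒# xy<0

  x²-nonneg : ∀ x → 0# ≤ x * x
  x²-nonneg x x²<0 with #⇒<⊎> (*-#0ˡ (<⇒# x²<0))
  ... | inj₂ 0<x = <.asym x²<0 (*-pos 0<x 0<x)
  ... | inj₁ x<0 = <.asym x²<0 (begin-strict
    0#            <⟨ *-pos 0<-x 0<-x ⟩
    - x * - x     ≈⟨ -‿distribˡ-* x (- x) ⟨
    - (x * - x)   ≈⟨ -‿cong (-‿distribʳ-* x x) ⟨
    - - (x * x)   ≈⟨ -‿involutive (x * x) ⟩
    x * x         ∎)
    where
    0<-x : 0# < - x
    0<-x = <.<-respʳ-≈ (+-identityˡ (- x)) (x<y⇒0<y-x x<0)

  *-monoˡ-≤ : ∀ {z} → 0# ≤ z → ∀ {x y} → x ≤ y → z * x ≤ z * y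
  *-monoˡ-≤ {z} 0≤z {x} {y} x≤y = begin
    z * x               ≤⟨ x≤x+y (*-nonneg 0≤z (x≤y⇒0≤y-x x≤y)) ⟩
    z * x + z * (y - x) ≈⟨ distribˡ z x (y - x) ⟨
    z * (x + (y - x))   ≈⟨ *-congˡ (x+[y-x]≈y x y) ⟩
    z * y               ∎

  *-monoʳ-≤ : ∀ {z} → 0# ≤ z → ∀ {x y} → x ≤ y → x * z ≤ y * z
  *-monoʳ-≤ {z} 0≤z {x} {y} x≤y = begin
    x * z ≈⟨ *-comm x z ⟩
    z * x ≤⟨ *-monoˡ-≤ 0≤z x≤y ⟩
    z * y ≈⟨ *-comm z y ⟩
    y * z ∎

  *-mono-≤ : ∀ {w x y z} → 0# ≤ w → 0# ≤ y → w ≤ x → y ≤ z → w * y ≤ x * z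
  *-mono-≤ 0≤w 0≤y w≤x y≤z =
    ≤-trans (*-monoʳ-≤ 0≤y w≤x) (*-monoˡ-≤ (≤-trans 0≤w w≤x) y≤z)

  *-monoˡ-< : ∀ {z} → 0# < z → ∀ {x y} → x < y → z * x < z * y
  *-monoˡ-< {z} 0<z {x} {y} x<y = begin-strict
    z * x               <⟨ x<x+y (*-pos 0<z (x<y⇒0<y-x x<y)) ⟩
    z * x + z * (y - x) ≈⟨ distribˡ z x (y - x) ⟨
    z * (x + (y - x))   ≈⟨ *-congˡ (x+[y-x]≈y x y) ⟩
    z * y               ∎

  *-cancelˡ-≤ : ∀ {z} → 0# < z → ∀ {x y} → z * x ≤ z * y → x ≤ y
  *-cancelˡ-≤ 0<z zx≤zy y<x = zx≤zy (*-monoˡ-< 0<z y<x)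

  *-cancelˡ-≈ : ∀ {z} → 0# < z → ∀ {x y} → z * x ≈ z * y → x ≈ y
  *-cancelˡ-≈ 0<z zx≈zy = ≤-antisym
    (*-cancelˡ-≤ 0<z (≤-reflexive zx≈zy)) (*-cancelˡ-≤ 0<z (≤-reflexive (sym zx≈zy)))

  *-pos-cancelˡ : ∀ {z x} → 0# < z → 0# < z * x → 0# < x
  *-pos-cancelˡ {z} {x} 0<z 0<zx with #⇒<⊎> (*-#0ʳ (#-sym (<⇒# 0<zx)))
  ... | inj₂ 0<x = 0<x
  ... | inj₁ x<0 = ⊥-elim (<.asym 0<zx (<.<-respʳ-≈ (zeroʳ z) (*-monoˡ-< 0<z x<0)))

  *-cancelˡ-< : ∀ {z} → 0# < z → ∀ {x y} → z * x < z * y → x < y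
  *-cancelˡ-< {z} 0<z {x} {y} zx<zy = begin-strict
    x           <⟨ x<x+y (*-pos-cancelˡ 0<z (<.<-respʳ-≈ eq (x<y⇒0<y-x zx<zy))) ⟩
    x + (y - x) ≈⟨ x+[y-x]≈y x y ⟩
    y           ∎
    where
    eq : z * y - z * x ≈ z * (y - x)
    eq = trans (+-congˡ (-‿distribʳ-* z x)) (sym (distribˡ z y (- x)))

  square-cancel-≤ : ∀ {x y} → 0# ≤ y → x * x ≤ y * y → x ≤ y
  square-cancel-≤ {x} {y} 0≤y x²≤y² y<x = x²≤y² (begin-strict
    y * y ≤⟨ *-monoˡ-≤ 0≤y (<⇒≤ y<x) ⟩
    y * x ≈⟨ *-comm y x ⟩
    x * y <⟨ *-monoˡ-< (≤-<-trans 0≤y y<x) y<x ⟩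
    x * x ∎)

  0≤x+x⇒0≤x : ∀ {x} → 0# ≤ x + x → 0# ≤ x
  0≤x+x⇒0≤x {x} 0≤x+x x<0 = 0≤x+x (begin-strict
    x + x  <⟨ +-monoʳ-< x x<0 ⟩
    x + 0# ≈⟨ +-identityʳ x ⟩
    x      <⟨ x<0 ⟩
    0#     ∎)

  -- The two sides differ by the square of `d = x - y`; writing `x` as `y + d` makes this a semiring
  -- identity.
  2xy≤x²+y² : ∀ x y → x * y + x * y ≤ x * x + y * y
  2xy≤x²+y² x y = begin
    x * y + x * y
      ≤⟨ x≤x+y (x²-nonneg d) ⟩
    (x * y + x * y) + d * d
      ≈⟨ +-congʳ (+-cong (*-congʳ y+d≈x) (*-congʳ y+d≈x)) ⟨
    ((y + d) * y + (y + d) * y) + d * d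
      ≈⟨ solve 2 (λ y d → ((y :+ d) :* y :+ (y :+ d) :* y) :+ d :* d
                       := (y :+ d) :* (y :+ d) :+ y :* y) refl y d ⟩
    (y + d) * (y + d) + y * y
      ≈⟨ +-congʳ (*-cong y+d≈x y+d≈x) ⟩
    x * x + y * y ∎
    where
    d = x - y
    y+d≈x = x+[y-x]≈y y x

  -- Twice the right-hand side is 1 + x² + (1 + x)². It later bounds `- u i` by 1 plus a square, in
  -- place of an absolute value.
  0≤1+x+x² : ∀ x → 0# ≤ 1# + x * x + x
  0≤1+x+x² x = 0≤x+x⇒0≤x (begin
    0#
      ≤⟨ +-nonneg (+-nonneg (<⇒≤ 0<1) (x²-nonneg x)) (x²-nonneg (1# + x)) ⟩
    (1# + x * x) + (1# + x) * (1# + x)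
      ≈⟨ solve 1 (λ x → (con 1 :+ x :* x) :+ (con 1 :+ x) :* (con 1 :+ x)
                     := (con 1 :+ x :* x :+ x) :+ (con 1 :+ x :* x :+ x)) refl x ⟩
    (1# + x * x + x) + (1# + x * x + x) ∎)

  √-nonneg : ∀ x 0≤x → 0# ≤ √ x 0≤x
  √-nonneg x 0≤x = proj₁ (proj₂ (√-exists x 0≤x))

  √-square : ∀ x 0≤x → √ x 0≤x * √ x 0≤x ≈ x
  √-square x 0≤x = proj₂ (proj₂ (√-exists x 0≤x))

  y*[x/y]≈x : ∀ x y y#0 → y * (x / y ⟨ y#0 ⟩) ≈ x
  y*[x/y]≈x x y y#0 = begin-equality
    y * (x * z)         ≈⟨ *-comm y (x * z) ⟩
    (x * z) * y         ≈⟨ *-assoc x z y ⟩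
    x * (z * y)         ≈⟨ *-congˡ (*-congˡ (x-0≈x y)) ⟨
    x * (z * (y - 0#))  ≈⟨ *-congˡ (proj₁ (proj₂ (#⇒invertible y#0))) ⟩
    x * 1#              ≈⟨ *-identityʳ x ⟩
    x                   ∎
    where z = proj₁ (#⇒invertible y#0)

  fromℕ-+ : ∀ j k → fromℕ (j ℕ.+ k) ≈ fromℕ j + fromℕ k
  fromℕ-+ zero    k = sym (+-identityˡ (fromℕ k))
  fromℕ-+ (suc j) k = trans (+-congˡ (fromℕ-+ j k)) (sym (+-assoc 1# (fromℕ j) (fromℕ k)))

  fromℕ-* : ∀ j k → fromℕ (j ℕ.* k) ≈ fromℕ j * fromℕ k
  fromℕ-* zero    k = sym (zeroˡ (fromℕ k))
  fromℕ-* (suc j) k = begin-equality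
    fromℕ (k ℕ.+ j ℕ.* k)         ≈⟨ fromℕ-+ k (j ℕ.* k) ⟩
    fromℕ k + fromℕ (j ℕ.* k)     ≈⟨ +-cong (sym (*-identityˡ _)) (fromℕ-* j k) ⟩
    1# * fromℕ k + fromℕ j * fromℕ k ≈⟨ distribʳ (fromℕ k) 1# (fromℕ j) ⟨
    (1# + fromℕ j) * fromℕ k      ∎

  1≤fromℕ : ∀ {k} → 0 ℕ.< k → 1# ≤ fromℕ k
  1≤fromℕ {suc k} _ = x≤x+y (fromℕ-nonneg k)

-- Finite sums, the dot product and the Cauchy-Schwarz inequality.

module FiniteSums {c ℓ₁ ℓ₂} (ℝ : RealNumbers c ℓ₁ ℓ₂) where
  open RealNumbers ℝ
  open OrderedField ℝ
  open ≤-Reasoning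
  open CommutativeRing commutativeRing using (semiring; commutativeSemiring)
  open SemiringSum semiring
    using (sum-cong-≋; ∑-distrib-+; *-distribˡ-sum; ∑-comm; sum-replicate-zero)
    public
  open SemiringSolver commutativeSemiring

  ∑-mono-≤ : ∀ {n} {v w : Vector Carrier n} → (∀ i → v i ≤ w i) → sum v ≤ sum w
  ∑-mono-≤ {zero}  v≤w = ≤-refl
  ∑-mono-≤ {suc n} v≤w = +-mono-≤ (v≤w Fin.zero) (∑-mono-≤ (v≤w ∘ Fin.suc))

  ∑-nonneg : ∀ {n} {v : Vector Carrier n} → (∀ i → 0# ≤ v i) → 0# ≤ sum v
  ∑-nonneg {zero}  0≤v = ≤-refl
  ∑-nonneg {suc n} 0≤v = +-nonneg (0≤v Fin.zero) (∑-nonneg (0≤v ∘ Fin.suc))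

  v≤∑v : ∀ {n} {v : Vector Carrier n} → (∀ i → 0# ≤ v i) → ∀ i → v i ≤ sum v
  v≤∑v 0≤v Fin.zero    = x≤x+y (∑-nonneg (0≤v ∘ Fin.suc))
  v≤∑v 0≤v (Fin.suc i) = ≤-trans (v≤∑v (0≤v ∘ Fin.suc) i) (y≤x+y (0≤v Fin.zero))

  infix 7 _∙_
  _∙_ : ∀ {n} → Vector Carrier n → Vector Carrier n → Carrier
  v ∙ w = sum (λ i → v i * w i)

  module _ {n : ℕ} where
    private variable u v w : Vector Carrier n

    ∙-cong : ∀ {v′ w′} → (∀ i → v i ≈ v′ i) → (∀ i → w i ≈ w′ i) → v ∙ w ≈ v′ ∙ w′
    ∙-cong v≈v′ w≈w′ = sum-cong-≋ λ i → *-cong (v≈v′ i) (w≈w′ i)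

    ∙-comm : ∀ (v w : Vector Carrier n) → v ∙ w ≈ w ∙ v
    ∙-comm v w = sum-cong-≋ λ i → *-comm (v i) (w i)

    ∙-distribˡ-+ : ∀ (u v w : Vector Carrier n) → u ∙ (λ i → v i + w i) ≈ u ∙ v + u ∙ w
    ∙-distribˡ-+ u v w = trans (sum-cong-≋ λ i → distribˡ (u i) (v i) (w i)) (∑-distrib-+ {n} _ _)

    ∙-*ˡ : ∀ a (v w : Vector Carrier n) → v ∙ (λ i → a * w i) ≈ a * (v ∙ w)
    ∙-*ˡ a v w = trans
      (sum-cong-≋ λ i → solve 3 (λ a v w → v :* (a :* w) := a :* (v :* w)) refl a (v i) (w i))
      (sym (*-distribˡ-sum {n} a (λ i → v i * w i)))

    ∙-nonneg : (∀ i → 0# ≤ v i) → (∀ i → 0# ≤ w i) → 0# ≤ v ∙ w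
    ∙-nonneg 0≤v 0≤w = ∑-nonneg λ i → *-nonneg (0≤v i) (0≤w i)

    ∙-monoˡ-≤ : (∀ i → 0# ≤ u i) → (∀ i → v i ≤ w i) → u ∙ v ≤ u ∙ w
    ∙-monoˡ-≤ 0≤u v≤w = ∑-mono-≤ λ i → *-monoˡ-≤ (0≤u i) (v≤w i)

    -- Summing 2(q wᵢ)(y vᵢ) ≤ (q wᵢ)² + (y vᵢ)² over i gives 2 q y² ≤ q² (w ∙ w) + y² q. Cancelling
    -- one q y² and then the positive factor q leaves the claim.
    cauchy-schwarz : ∀ (v w : Vector Carrier n) → 0# < v ∙ v →
                     (v ∙ w) * (v ∙ w) ≤ (v ∙ v) * (w ∙ w)
    cauchy-schwarz v w 0<q = *-cancelˡ-≤ 0<q (+-cancelʳ-≤ (q * (y * y)) (begin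
      q * (y * y) + q * (y * y)
        ≈⟨ solve 2 (λ q y → q :* (y :* y) :+ q :* (y :* y)
                         := q :* y :* y :+ q :* y :* y) refl q y ⟩
      q * y * y + q * y * y
        ≈⟨ +-cong (*-distribˡ-sum {n} (q * y) _) (*-distribˡ-sum {n} (q * y) _) ⟩
      sum (λ i → q * y * (v i * w i)) + sum (λ i → q * y * (v i * w i))
        ≈⟨ ∑-distrib-+ {n} _ _ ⟨
      sum (λ i → q * y * (v i * w i) + q * y * (v i * w i))
        ≤⟨ ∑-mono-≤ (λ i → begin
          q * y * (v i * w i) + q * y * (v i * w i)
            ≈⟨ solve 4 (λ q y v w → q :* y :* (v :* w) :+ q :* y :* (v :* w)
                 := (q :* w) :* (y :* v) :+ (q :* w) :* (y :* v)) refl q y (v i) (w i) ⟩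
          (q * w i) * (y * v i) + (q * w i) * (y * v i)
            ≤⟨ 2xy≤x²+y² (q * w i) (y * v i) ⟩
          (q * w i) * (q * w i) + (y * v i) * (y * v i)
            ≈⟨ solve 4 (λ q y v w → (q :* w) :* (q :* w) :+ (y :* v) :* (y :* v)
                 := q :* q :* (w :* w) :+ y :* y :* (v :* v)) refl q y (v i) (w i) ⟩
          q * q * (w i * w i) + y * y * (v i * v i) ∎) ⟩
      sum (λ i → q * q * (w i * w i) + y * y * (v i * v i))
        ≈⟨ ∑-distrib-+ {n} _ _ ⟩
      sum (λ i → q * q * (w i * w i)) + sum (λ i → y * y * (v i * v i))
        ≈⟨ +-cong (*-distribˡ-sum {n} (q * q) _) (*-distribˡ-sum {n} (y * y) _) ⟨
      q * q * (w ∙ w) + y * y * q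
        ≈⟨ solve 3 (λ q y p → q :* q :* p :+ y :* y :* q
                           := q :* (q :* p) :+ q :* (y :* y)) refl q y (w ∙ w) ⟩
      q * (q * (w ∙ w)) + q * (y * y) ∎))
      where
      q = v ∙ v
      y = v ∙ w

-- Nested intervals, powers and roots of order 2ᵏ, and growth rates.

module Limits {c ℓ₁ ℓ₂} (ℝ : RealNumbers c ℓ₁ ℓ₂) where
  open RealNumbers ℝ
  open RealOperations ℝ
  open OrderedField ℝ
  open ≤-Reasoning
  open CommutativeRing commutativeRing using (commutativeSemiring)
  open SemiringSolver commutativeSemiring

  increasing : ∀ {a : ℕ → Carrier} → (∀ k → a k ≤ a (suc k)) →
               ∀ {i j} → i ℕ.≤ j → a i ≤ a j
  increasing step = go ∘ ℕ.≤⇒≤′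
    where
    go : ∀ {i j} → i ℕ.≤′ j → _
    go ℕ.≤′-refl         = ≤-refl
    go (ℕ.≤′-step i≤j) = ≤-trans (go i≤j) (step _)

  decreasing : ∀ {a : ℕ → Carrier} → (∀ k → a (suc k) ≤ a k) →
               ∀ {i j} → i ℕ.≤ j → a j ≤ a i
  decreasing step = go ∘ ℕ.≤⇒≤′
    where
    go : ∀ {i j} → i ℕ.≤′ j → _
    go ℕ.≤′-refl         = ≤-refl
    go (ℕ.≤′-step i≤j) = ≤-trans (step _) (go i≤j)

  -- Beyond index N all left ends lie in the interval from `a N` to `b N`, so short intervals make
  -- `a` a Cauchy sequence; its limit is the common point.
  nested-intervals : ∀ (a b : ℕ → Carrier) →
    (∀ k → a k ≤ a (suc k)) → (∀ k → b (suc k) ≤ b k) → (∀ k → a k ≤ b k) →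
    (∀ ε → 0# < ε → ∃[ k ] b k < a k + ε) →
    ∃[ l ] (∀ k → a k ≤ l × l ≤ b k)
  nested-intervals a b a↗ b↘ a≤b shrink =
    l , λ k → (λ l<aₖ → lower k l<aₖ) , (λ bₖ<l → upper k bₖ<l)
    where
    a-cauchy : IsCauchy a
    a-cauchy ε 0<ε with shrink ε 0<ε
    ... | N , bN<aN+ε = N , λ i j N≤i N≤j → begin-strict
      a i     ≤⟨ a≤b i ⟩
      b i     ≤⟨ decreasing b↘ N≤i ⟩
      b N     <⟨ bN<aN+ε ⟩
      a N + ε ≤⟨ +-monoˡ-≤ ε (increasing a↗ N≤j) ⟩
      a j + ε ∎

    l   = proj₁ (complete a a-cauchy)
    a→l = proj₂ (complete a a-cauchy)

    lower : ∀ k → a k ≤ l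
    -- The supposed gap `a k - l` itself is the tolerance: a late term of `a` would have to lie
    -- below `a k`.
    lower k l<aₖ with a→l (a k - l) (x<y⇒0<y-x l<aₖ)
    ... | N , near = <.irrefl refl (begin-strict
      a k             ≤⟨ increasing a↗ (ℕ.m≤m⊔n k N) ⟩
      a (k ℕ.⊔ N)     <⟨ proj₁ (near (k ℕ.⊔ N) (ℕ.m≤n⊔m k N)) ⟩
      l + (a k - l)   ≈⟨ x+[y-x]≈y l (a k) ⟩
      a k             ∎)

    upper : ∀ k → l ≤ b k
    upper k bₖ<l with a→l (l - b k) (x<y⇒0<y-x bₖ<l)
    ... | N , near = <.irrefl refl (begin-strict
      l                       <⟨ proj₂ (near i (ℕ.m≤n⊔m k N)) ⟩
      a i + (l - b k)         ≤⟨ +-monoˡ-≤ _ (a≤b i) ⟩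
      b i + (l - b k)         ≤⟨ +-monoˡ-≤ _ (decreasing b↘ (ℕ.m≤m⊔n k N)) ⟩
      b k + (l - b k)         ≈⟨ x+[y-x]≈y (b k) l ⟩
      l                       ∎)
      where i = k ℕ.⊔ N

  infixr 8 _^2^_
  -- The power with exponent 2ᵏ, by repeated squaring.
  _^2^_ : Carrier → ℕ → Carrier
  x ^2^ zero  = x
  x ^2^ suc k = x ^2^ k * x ^2^ k

  ^2^-nonneg : ∀ {x} k → 0# ≤ x → 0# ≤ x ^2^ k
  ^2^-nonneg zero    0≤x = 0≤x
  ^2^-nonneg (suc k) 0≤x = x²-nonneg _

  ^2^-pos : ∀ {x} k → 0# < x → 0# < x ^2^ k
  ^2^-pos zero    0<x = 0<x
  ^2^-pos (suc k) 0<x = *-pos (^2^-pos k 0<x) (^2^-pos k 0<x)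

  ^2^-cong : ∀ {x y} k → x ≈ y → x ^2^ k ≈ y ^2^ k
  ^2^-cong zero    x≈y = x≈y
  ^2^-cong (suc k) x≈y = *-cong (^2^-cong k x≈y) (^2^-cong k x≈y)

  ^2^-mono-≤ : ∀ {x y} k → 0# ≤ x → x ≤ y → x ^2^ k ≤ y ^2^ k
  ^2^-mono-≤ zero    0≤x x≤y = x≤y
  ^2^-mono-≤ (suc k) 0≤x x≤y = *-mono-≤ 0≤xᵏ 0≤xᵏ xᵏ≤yᵏ xᵏ≤yᵏ
    where
    0≤xᵏ  = ^2^-nonneg k 0≤x
    xᵏ≤yᵏ = ^2^-mono-≤ k 0≤x x≤y

  ^2^-cancel-≤ : ∀ {x y} k → 0# ≤ y → x ^2^ k ≤ y ^2^ k → x ≤ y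
  ^2^-cancel-≤ zero    0≤y x≤y   = x≤y
  ^2^-cancel-≤ (suc k) 0≤y xᵏ≤yᵏ = ^2^-cancel-≤ k 0≤y (square-cancel-≤ (^2^-nonneg k 0≤y) xᵏ≤yᵏ)

  ^2^-distrib-* : ∀ x y k → (x * y) ^2^ k ≈ x ^2^ k * y ^2^ k
  ^2^-distrib-* x y zero    = refl
  ^2^-distrib-* x y (suc k) = trans (*-cong (^2^-distrib-* x y k) (^2^-distrib-* x y k))
    (solve 2 (λ a b → (a :* b) :* (a :* b) := (a :* a) :* (b :* b)) refl (x ^2^ k) (y ^2^ k))

  1^2^k≈1 : ∀ k → 1# ^2^ k ≈ 1#
  1^2^k≈1 zero    = refl
  1^2^k≈1 (suc k) = trans (*-cong (1^2^k≈1 k) (1^2^k≈1 k)) (*-identityˡ 1#)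

  -- The exponent 2ᵏ is weakened to k + 1, since growth linear in k suffices. Squaring the bound for
  -- k leaves the nonnegative surplus j x + ((1 + j) x)², where j is k.
  bernoulli : ∀ {x} → 0# ≤ x → ∀ k → 1# + fromℕ (suc k) * x ≤ (1# + x) ^2^ k
  bernoulli {x} 0≤x zero    = ≤-reflexive
    (solve 1 (λ x → con 1 :+ (con 1 :+ con 0) :* x := con 1 :+ x) refl x)
  bernoulli {x} 0≤x (suc k) = begin
    1# + (1# + (1# + j)) * x
      ≤⟨ x≤x+y (+-nonneg (*-nonneg 0≤j 0≤x) (x²-nonneg _)) ⟩
    1# + (1# + (1# + j)) * x + (j * x + ((1# + j) * x) * ((1# + j) * x))
      ≈⟨ solve 2 (λ j x →
           con 1 :+ (con 1 :+ (con 1 :+ j)) :* x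
             :+ (j :* x :+ ((con 1 :+ j) :* x) :* ((con 1 :+ j) :* x))
             := (con 1 :+ (con 1 :+ j) :* x) :* (con 1 :+ (con 1 :+ j) :* x)) refl j x ⟩
    (1# + (1# + j) * x) * (1# + (1# + j) * x)
      ≤⟨ *-mono-≤ 0≤b 0≤b (bernoulli 0≤x k) (bernoulli 0≤x k) ⟩
    (1# + x) ^2^ suc k ∎
    where
    j = fromℕ k
    0≤j = fromℕ-nonneg k
    0≤b : 0# ≤ 1# + (1# + j) * x
    0≤b = +-nonneg (<⇒≤ 0<1) (*-nonneg (fromℕ-nonneg (suc k)) 0≤x)

  root : ∀ k {y} → 0# ≤ y → ∃[ x ] 0# ≤ x × x ^2^ k ≈ y
  root zero    {y} 0≤y = y , 0≤y , refl
  root (suc k) {y} 0≤y with √-exists y 0≤y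
  ... | s , 0≤s , s²≈y with root k 0≤s
  ...   | x , 0≤x , xᵏ≈s = x , 0≤x , trans (*-cong xᵏ≈s xᵏ≈s) s²≈y

  -- The limit of y k to the power 2⁻ᵏ. It lies in all the intervals [ a k , b k ]
  -- where a k and b k are the roots of y k / q and of y k.
  growth-rate : ∀ {q} (y : ℕ → Carrier) → 1# ≤ q → 0# < y 0 → (∀ k → 0# ≤ y k) →
    (∀ k → y (suc k) ≤ y k * y k) → (∀ k → y k * y k ≤ q * y (suc k)) →
    ∃[ κ ] 0# < κ × y 0 ≤ q * κ × (∀ k → κ ^2^ k ≤ y k × y k ≤ q * κ ^2^ k)
  growth-rate {q} y 1≤q 0<y₀ 0≤y y-upper y-lower =
    -- `a 0` computes to `z 0`, which is y 0 / q, so the left end at index 0 gives both the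
    -- positivity of κ and y 0 ≤ q κ.
    κ , <-≤-trans 0<z₀ (a≤κ 0) , y₀≤qκ , λ k → (begin
      κ ^2^ k   ≤⟨ ^2^-mono-≤ k 0≤κ (κ≤b k) ⟩
      b k ^2^ k ≈⟨ b^ k ⟩
      y k       ∎) , (begin
      y k             ≈⟨ qz≈y k ⟨
      q * z k         ≈⟨ *-congˡ (a^ k) ⟨
      q * a k ^2^ k   ≤⟨ *-monoˡ-≤ 0≤q (^2^-mono-≤ k (0≤a k) (a≤κ k)) ⟩
      q * κ ^2^ k     ∎)
    where
    0<q : 0# < q
    0<q = <-≤-trans 0<1 1≤q
    0≤q = <⇒≤ 0<q

    z : ℕ → Carrier
    z k = y k / q ⟨ #-sym (<⇒# 0<q) ⟩

    qz≈y : ∀ k → q * z k ≈ y k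
    qz≈y k = y*[x/y]≈x (y k) q _

    0≤z : ∀ k → 0# ≤ z k
    0≤z k = *-cancelˡ-≤ 0<q (begin
      q * 0#  ≈⟨ zeroʳ q ⟩
      0#      ≤⟨ 0≤y k ⟩
      y k     ≈⟨ qz≈y k ⟨
      q * z k ∎)

    0<z₀ : 0# < z 0
    0<z₀ = *-pos-cancelˡ 0<q (<.<-respʳ-≈ (sym (qz≈y 0)) 0<y₀)

    a b : ℕ → Carrier
    a k = proj₁ (root k (0≤z k))
    b k = proj₁ (root k (0≤y k))

    0≤a : ∀ k → 0# ≤ a k
    0≤a k = proj₁ (proj₂ (root k (0≤z k)))
    0≤b : ∀ k → 0# ≤ b k
    0≤b k = proj₁ (proj₂ (root k (0≤y k)))

    a^ : ∀ k → a k ^2^ k ≈ z k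
    a^ k = proj₂ (proj₂ (root k (0≤z k)))
    b^ : ∀ k → b k ^2^ k ≈ y k
    b^ k = proj₂ (proj₂ (root k (0≤y k)))

    z≤y : ∀ k → z k ≤ y k
    z≤y k = begin
      z k      ≈⟨ *-identityˡ (z k) ⟨
      1# * z k ≤⟨ *-monoʳ-≤ (0≤z k) 1≤q ⟩
      q * z k  ≈⟨ qz≈y k ⟩
      y k      ∎

    a≤b : ∀ k → a k ≤ b k
    a≤b k = ^2^-cancel-≤ k (0≤b k) (begin
      a k ^2^ k ≈⟨ a^ k ⟩
      z k       ≤⟨ z≤y k ⟩
      y k       ≈⟨ b^ k ⟨
      b k ^2^ k ∎)

    -- After raising to the power 2ᵏ⁺¹ this is `y-lower k` divided by q².
    a↗ : ∀ k → a k ≤ a (suc k)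
    a↗ k = ^2^-cancel-≤ (suc k) (0≤a (suc k)) (begin
      a k ^2^ suc k         ≈⟨ *-cong (a^ k) (a^ k) ⟩
      z k * z k             ≤⟨ *-cancelˡ-≤ 0<q (*-cancelˡ-≤ 0<q (begin
        q * (q * (z k * z k))   ≈⟨ solve 2 (λ q z → q :* (q :* (z :* z))
                                     := (q :* z) :* (q :* z)) refl q (z k) ⟩
        (q * z k) * (q * z k)   ≈⟨ *-cong (qz≈y k) (qz≈y k) ⟩
        y k * y k               ≤⟨ y-lower k ⟩
        q * y (suc k)           ≈⟨ *-congˡ (qz≈y (suc k)) ⟨
        q * (q * z (suc k))     ∎)) ⟩
      z (suc k)             ≈⟨ a^ (suc k) ⟨
      a (suc k) ^2^ suc k   ∎)

    -- After raising to the power 2ᵏ⁺¹ this is `y-upper k`.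
    b↘ : ∀ k → b (suc k) ≤ b k
    b↘ k = ^2^-cancel-≤ (suc k) (0≤b k) (begin
      b (suc k) ^2^ suc k ≈⟨ b^ (suc k) ⟩
      y (suc k)           ≤⟨ y-upper k ⟩
      y k * y k           ≈⟨ *-cong (b^ k) (b^ k) ⟨
      b k ^2^ suc k       ∎)

    -- Write the root of q as 1 + e k; then b k = a k (1 + e k), and e k tends to 0
    -- by Bernoulli's inequality.
    ρ e : ℕ → Carrier
    ρ k = proj₁ (root k 0≤q)
    e k = ρ k - 1#

    ρ^ : ∀ k → ρ k ^2^ k ≈ q
    ρ^ k = proj₂ (proj₂ (root k 0≤q))

    0≤ρ : ∀ k → 0# ≤ ρ k
    0≤ρ k = proj₁ (proj₂ (root k 0≤q))

    1+e≈ρ : ∀ k → 1# + e k ≈ ρ k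
    1+e≈ρ k = x+[y-x]≈y 1# (ρ k)

    0≤e : ∀ k → 0# ≤ e k
    0≤e k = x≤y⇒0≤y-x (^2^-cancel-≤ k (0≤ρ k) (begin
      1# ^2^ k  ≈⟨ 1^2^k≈1 k ⟩
      1#        ≤⟨ 1≤q ⟩
      q         ≈⟨ ρ^ k ⟨
      ρ k ^2^ k ∎))

    ke≤q : ∀ k → fromℕ (suc k) * e k ≤ q
    ke≤q k = begin
      fromℕ (suc k) * e k       ≤⟨ y≤x+y (<⇒≤ 0<1) ⟩
      1# + fromℕ (suc k) * e k  ≤⟨ bernoulli (0≤e k) k ⟩
      (1# + e k) ^2^ k          ≈⟨ ^2^-cong k (1+e≈ρ k) ⟩
      ρ k ^2^ k                 ≈⟨ ρ^ k ⟩
      q                         ∎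

    b≤aρ : ∀ k → b k ≤ a k * ρ k
    b≤aρ k = ^2^-cancel-≤ k (*-nonneg (0≤a k) (0≤ρ k)) (begin
      b k ^2^ k             ≈⟨ b^ k ⟩
      y k                   ≈⟨ qz≈y k ⟨
      q * z k               ≈⟨ *-comm q (z k) ⟩
      z k * q               ≈⟨ *-cong (a^ k) (ρ^ k) ⟨
      a k ^2^ k * ρ k ^2^ k ≈⟨ ^2^-distrib-* (a k) (ρ k) k ⟨
      (a k * ρ k) ^2^ k     ∎)

    b≤a+b₀e : ∀ k → b k ≤ a k + b 0 * e k
    b≤a+b₀e k = begin
      b k                ≤⟨ b≤aρ k ⟩
      a k * ρ k          ≈⟨ *-congˡ (1+e≈ρ k) ⟨
      a k * (1# + e k)   ≈⟨ solve 2 (λ a e → a :* (con 1 :+ e) := a :+ a :* e) refl (a k) (e k) ⟩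
      -- The factor `a k` is replaced by `b 0`, a bound uniform in `k`.
      a k + a k * e k    ≤⟨ +-monoʳ-≤ (a k) (*-monoʳ-≤ (0≤e k) (≤-trans (a≤b k) (decreasing b↘ {0} {k} ℕ.z≤n))) ⟩
      a k + b 0 * e k    ∎

    b₀e<ε : ∀ {ε k} → 0# < ε → b 0 * q < ε * fromℕ k → b 0 * e k < ε
    b₀e<ε {ε} {k} 0<ε b₀q<εk = *-cancelˡ-< (fromℕ-pos {suc k} ℕ.z<s) (begin-strict
      fromℕ (suc k) * (b 0 * e k)  ≈⟨ solve 3 (λ k b e → k :* (b :* e) := b :* (k :* e))
                                        refl (fromℕ (suc k)) (b 0) (e k) ⟩
      b 0 * (fromℕ (suc k) * e k)  ≤⟨ *-monoˡ-≤ (0≤b 0) (ke≤q k) ⟩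
      b 0 * q                      <⟨ b₀q<εk ⟩
      ε * fromℕ k                  ≈⟨ *-comm ε (fromℕ k) ⟩
      fromℕ k * ε                  ≤⟨ *-monoʳ-≤ (<⇒≤ 0<ε) (y≤x+y (<⇒≤ 0<1)) ⟩
      fromℕ (suc k) * ε            ∎)

    shrink : ∀ ε → 0# < ε → ∃[ k ] b k < a k + ε
    -- The Archimedean property gives `k` above b₀ q / ε, and by `ke≤q` the interval is no longer
    -- than b₀ q / (k + 1).
    shrink ε 0<ε = k , ≤-<-trans (b≤a+b₀e k) (+-monoʳ-< (a k) (b₀e<ε {k = k} 0<ε
      (<.<-respˡ-≈ (y*[x/y]≈x (b 0 * q) ε ε#0) (*-monoˡ-< 0<ε (proj₂ bound)))))
      where
      ε#0   = #-sym (<⇒# 0<ε)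
      bound = archimedean ((b 0 * q) / ε ⟨ ε#0 ⟩)
      k     = proj₁ bound

    limit = nested-intervals a b a↗ b↘ a≤b shrink
    κ = proj₁ limit

    a≤κ : ∀ k → a k ≤ κ
    a≤κ k = proj₁ (proj₂ limit k)
    κ≤b : ∀ k → κ ≤ b k
    κ≤b k = proj₂ (proj₂ limit k)

    0≤κ : 0# ≤ κ
    0≤κ = ≤-trans (0≤a 0) (a≤κ 0)

    y₀≤qκ : y 0 ≤ q * κ
    y₀≤qκ = ≤-trans (≤-reflexive (sym (qz≈y 0))) (*-monoˡ-≤ 0≤q (a≤κ 0))

-- Gaussian elimination and the Fredholm alternative.

module LinearSystems {c ℓ₁ ℓ₂} (ℝ : RealNumbers c ℓ₁ ℓ₂) where
  open RealNumbers ℝ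
  open RealOperations ℝ
  open OrderedField ℝ
  open FiniteSums ℝ
  open ≤-Reasoning
  open CommutativeRing commutativeRing using (commutativeSemiring; ring)
  open RingProperties ring using (-‿distribˡ-*; +-cancelʳ)
  open SemiringSolver commutativeSemiring

  infix 4 _·_≋_
  _·_≋_ : ∀ {m n} → (Fin m → Fin n → Carrier) → Vector Carrier n → Vector Carrier m → Set ℓ₁
  M · v ≋ w = ∀ i → M i ∙ v ≈ w i

  Singular : ∀ {n} → Matrix n → Set _
  Singular M = ∃[ v ] (∃[ i ] v i # 0#) × M · v ≋ (λ _ → 0#)

  module Pivot {n} (M : Matrix (suc n)) (p : Fin (suc n)) (Mₚ₀#0 : M p Fin.zero # 0#) where
    Mₚ₀ = M p Fin.zero

    -- The multiple of row `p` that clears the entry in column zero when added to the i-th remaining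
    -- row.
    factor : Fin n → Carrier
    factor i = - (M (Fin.punchIn p i) Fin.zero) / Mₚ₀ ⟨ Mₚ₀#0 ⟩

    schur : Matrix n
    schur i j = M (Fin.punchIn p i) (Fin.suc j) + factor i * M p (Fin.suc j)

    reduce : Vector Carrier (suc n) → Vector Carrier n
    reduce b i = b (Fin.punchIn p i) + factor i * b p

    -- Back substitution: the value that row `p` forces on the first unknown once the others are
    -- `v`.
    first : Vector Carrier (suc n) → Vector Carrier n → Carrier
    first b v = (b p - (λ j → M p (Fin.suc j)) ∙ v) / Mₚ₀ ⟨ Mₚ₀#0 ⟩

    pivot-row : ∀ b v → M p ∙ (first b v ∷ᵛ v) ≈ b p
    pivot-row b v = begin-equality
      Mₚ₀ * first b v + s ≈⟨ +-congʳ (y*[x/y]≈x _ Mₚ₀ Mₚ₀#0) ⟩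
      (b p - s) + s       ≈⟨ +-comm _ s ⟩
      s + (b p - s)       ≈⟨ x+[y-x]≈y s (b p) ⟩
      b p                 ∎
      where s = (λ j → M p (Fin.suc j)) ∙ v

    -- Adding `factor i` times the pivot equation cancels the coefficient of the first unknown and
    -- leaves the i-th equation of the reduced system.
    other-row : ∀ b v → schur · v ≋ reduce b →
                ∀ i → M (Fin.punchIn p i) ∙ (first b v ∷ᵛ v) ≈ b (Fin.punchIn p i)
    other-row b v eq i = +-cancelʳ (f * b p) _ _ (begin-equality
      (Mᵢ₀ * u + Mᵢ ∙ v) + f * b p
        ≈⟨ +-congˡ (*-congˡ (pivot-row b v)) ⟨
      (Mᵢ₀ * u + Mᵢ ∙ v) + f * (Mₚ₀ * u + Mₚ ∙ v)
        ≈⟨ solve 6 (λ a u s f c t → (a :* u :+ s) :+ f :* (c :* u :+ t)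
                                 := (a :+ c :* f) :* u :+ (s :+ f :* t))
             refl Mᵢ₀ u (Mᵢ ∙ v) f Mₚ₀ (Mₚ ∙ v) ⟩
      (Mᵢ₀ + Mₚ₀ * f) * u + (Mᵢ ∙ v + f * (Mₚ ∙ v))
        ≈⟨ +-congʳ (*-congʳ (trans (+-congˡ (y*[x/y]≈x _ Mₚ₀ Mₚ₀#0)) (-‿inverseʳ Mᵢ₀))) ⟩
      0# * u + (Mᵢ ∙ v + f * (Mₚ ∙ v))
        ≈⟨ trans (+-congʳ (zeroˡ u)) (+-identityˡ _) ⟩
      Mᵢ ∙ v + f * (Mₚ ∙ v)
        ≈⟨ +-congˡ (*-distribˡ-sum {n} f (λ j → Mₚ j * v j)) ⟩
      Mᵢ ∙ v + sum (λ j → f * (Mₚ j * v j))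
        ≈⟨ ∑-distrib-+ {n} _ _ ⟨
      sum (λ j → Mᵢ j * v j + f * (Mₚ j * v j))
        ≈⟨ sum-cong-≋ {n} (λ j → solve 4 (λ a v f c → a :* v :+ f :* (c :* v)
             := (a :+ f :* c) :* v) refl (Mᵢ j) (v j) f (Mₚ j)) ⟩
      schur i ∙ v
        ≈⟨ eq i ⟩
      b (Fin.punchIn p i) + f * b p ∎)
      where
      f   = factor i
      u   = first b v
      Mᵢ₀ = M (Fin.punchIn p i) Fin.zero
      Mᵢ Mₚ : Vector Carrier n
      Mᵢ j = M (Fin.punchIn p i) (Fin.suc j)
      Mₚ j = M p (Fin.suc j)

    extend : ∀ b v → schur · v ≋ reduce b → M · (first b v ∷ᵛ v) ≋ b
    extend b v eq i with p Fin.≟ i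
    ... | yes ≡.refl = pivot-row b v
    ... | no  p≢i    = ≡.subst (λ i → M i ∙ (first b v ∷ᵛ v) ≈ b i)
      (Fin.punchIn-punchOut p≢i) (other-row b v eq (Fin.punchOut p≢i))

    singular : Singular schur → Singular M
    singular (v , (i , vᵢ#0) , eq) =
      first (λ _ → 0#) v ∷ᵛ v , (Fin.suc i , vᵢ#0) , extend (λ _ → 0#) v λ j →
        trans (eq j) (sym (trans (+-identityˡ _) (zeroʳ _)))

  -- Whether a pivot exists is not decidable, hence the double negation.
  nonsingular⇒solvable : ∀ {n} (M : Matrix n) b → ¬ Singular M → ¬ ¬ (∃[ v ] M · v ≋ b)
  nonsingular⇒solvable {zero}  M b _    unsolvable = unsolvable (b , λ ())
  nonsingular⇒solvable {suc n} M b ¬sing unsolvable = ¬sing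
    -- If the system has no solution, column zero vanishes, and then the first unit vector lies in
    -- the kernel.
    ( (1# ∷ᵛ λ _ → 0#) , (Fin.zero , 1#0) , λ i → begin-equality
        M i Fin.zero * 1# + sum (λ j → M i (Fin.suc j) * 0#)
          ≈⟨ +-cong (trans (*-identityʳ _) (column≈0 i))
                    (trans (sum-cong-≋ {n} (λ j → zeroʳ _)) (sum-replicate-zero n)) ⟩
        0# + 0#
          ≈⟨ +-identityˡ 0# ⟩
        0# ∎)
    where
    column≈0 : ∀ p → M p Fin.zero ≈ 0#
    -- An entry apart from zero would serve as a pivot: the Schur complement inherits
    -- nonsingularity, and a solution of the reduced system extends to the excluded one. Tightness
    -- turns this refutation into equality with zero.
    column≈0 p = proj₁ (tight _ _) λ Mₚ₀#0 →
      let open Pivot M p Mₚ₀#0 in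
      nonsingular⇒solvable schur (reduce b) (¬sing ∘ singular) λ (v , eq) →
        unsolvable (first b v ∷ᵛ v , extend b v eq)

  scalar : ∀ {n} → Carrier → Matrix n
  scalar a i j = if does (i Fin.≟ j) then a else 0#

  scalar-∙ : ∀ {n} a (v : Vector Carrier n) → scalar a · v ≋ (λ i → a * v i)
  scalar-∙ {suc n} a v Fin.zero = trans
    (+-congˡ (trans (sum-cong-≋ {n} (λ j → zeroˡ _)) (sum-replicate-zero n)))
    (+-identityʳ _)
  scalar-∙ {suc n} a v (Fin.suc i) =
    trans (+-cong (zeroˡ _) (scalar-∙ a (v ∘ Fin.suc) i)) (+-identityˡ _)

  module _ {n} (A : Matrix n) (κ : Carrier) where

    shifted : Matrix n
    shifted i j = A i j + scalar (- κ) i j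

    shifted-∙ : ∀ (v : Vector Carrier n) → ∀ i → shifted i ∙ v + κ * v i ≈ A i ∙ v
    shifted-∙ v i = begin-equality
      shifted i ∙ v + κ * v i
        ≈⟨ +-congʳ (trans (sum-cong-≋ {n} (λ j → distribʳ (v j) _ _)) (∑-distrib-+ {n} _ _)) ⟩
      (A i ∙ v + scalar (- κ) i ∙ v) + κ * v i
        ≈⟨ +-congʳ (+-congˡ (trans (scalar-∙ (- κ) v i) (sym (-‿distribˡ-* κ (v i))))) ⟩
      (A i ∙ v - κ * v i) + κ * v i
        ≈⟨ trans (+-comm _ _) (x+[y-x]≈y (κ * v i) (A i ∙ v)) ⟩
      A i ∙ v ∎

    -- The equation says that A - κ sends `u` to `- b`, and a nonzero kernel vector of A - κ is an
    -- eigenvector for κ.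
    fredholm : ∀ (b : Vector Carrier n) → ¬ IsEigenvalue A κ →
               ¬ ¬ (∃[ u ] ∀ i → κ * u i ≈ A i ∙ u + b i)
    fredholm b ¬eigen unsolvable = nonsingular⇒solvable shifted (λ i → - b i)
      (λ (v , v#0 , eq) → ¬eigen (v , v#0 , λ i → begin-equality
        A i ∙ v                 ≈⟨ shifted-∙ v i ⟨
        shifted i ∙ v + κ * v i ≈⟨ +-congʳ (eq i) ⟩
        0# + κ * v i            ≈⟨ +-identityˡ _ ⟩
        κ * v i                 ∎))
      (λ (u , eq) → unsolvable (u , λ i → begin-equality
        κ * u i                           ≈⟨ x+y-y≈x (κ * u i) (b i) ⟨
        (κ * u i + b i) - b i             ≈⟨ trans (+-assoc _ _ _) (trans (+-congˡ (+-comm _ _)) (sym (+-assoc _ _ _))) ⟩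
        (κ * u i - b i) + b i             ≈⟨ +-congʳ (+-comm _ _) ⟩
        (- b i + κ * u i) + b i           ≈⟨ +-congʳ (+-congʳ (eq i)) ⟨
        (shifted i ∙ u + κ * u i) + b i   ≈⟨ +-congʳ (shifted-∙ u i) ⟩
        A i ∙ u + b i                     ∎))

-- The Rayleigh inequality for nonnegative symmetric matrices.

module Spectral {c ℓ₁ ℓ₂} (ℝ : RealNumbers c ℓ₁ ℓ₂) where
  open RealNumbers ℝ
  open RealOperations ℝ
  open OrderedField ℝ
  open FiniteSums ℝ
  open Limits ℝ
  open LinearSystems ℝ
  open ≤-Reasoning
  open CommutativeRing commutativeRing using (commutativeSemiring)
  open SemiringSolver commutativeSemiring

  NonNegative : ∀ {n} → Vector Carrier n → Set ℓ₂
  NonNegative v = ∀ i → 0# ≤ v i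

  -- The last field says that the image of L lives where x is at least 1.
  record IsPositiveSymmetric {n} (x : Vector Carrier n)
         (L : Vector Carrier n → Vector Carrier n) : Set (c ⊔ ℓ₁ ⊔ ℓ₂) where
    field
      L-cong : ∀ {v w} → (∀ i → v i ≈ w i) → ∀ i → L v i ≈ L w i
      L-+    : ∀ v w i → L (λ j → v j + w j) i ≈ L v i + L w i
      L-*    : ∀ a v i → L (λ j → a * v j) i ≈ a * L v i
      L-sym  : ∀ v w → L v ∙ w ≈ v ∙ L w
      L-pos  : ∀ {v} → NonNegative v → NonNegative (L v)
      L≤x*L  : ∀ {v} → NonNegative v → ∀ i → L v i ≤ x i * L v i

    module _ (0≤x : NonNegative x) where

      private y = x ∙ L x

      x∙Lx-nonneg : 0# ≤ y
      x∙Lx-nonneg = ∙-nonneg 0≤x (L-pos 0≤x)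

      -- By symmetry the left side is L x ∙ L x. In each term one factor is at most `x i * L x i`,
      -- and the other is at most the whole sum `y` of these.
      x∙LLx≤[x∙Lx]² : x ∙ L (L x) ≤ y * y
      x∙LLx≤[x∙Lx]² = begin
        x ∙ L (L x)                        ≈⟨ L-sym x (L x) ⟨
        L x ∙ L x                          ≤⟨ ∑-mono-≤ (λ i → begin
          L x i * L x i                      ≤⟨ *-mono-≤ (0≤Lx i) (0≤Lx i) (Lx≤y i) (Lx≤xLx i) ⟩
          y * (x i * L x i)                  ∎) ⟩
        sum (λ i → y * (x i * L x i))      ≈⟨ *-distribˡ-sum {n} y _ ⟨
        y * y                              ∎
        where
        0≤Lx   = L-pos 0≤x
        Lx≤xLx = L≤x*L 0≤x
        Lx≤y : ∀ i → L x i ≤ y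
        Lx≤y i = ≤-trans (Lx≤xLx i) (v≤∑v (λ j → *-nonneg (0≤x j) (0≤Lx j)) i)

      -- Cauchy-Schwarz for `x` and `L x`, with one `L` moved across by symmetry.
      [x∙Lx]²≤x∙x*x∙LLx : 0# < x ∙ x → y * y ≤ (x ∙ x) * (x ∙ L (L x))
      [x∙Lx]²≤x∙x*x∙LLx 0<q = begin
        y * y                   ≤⟨ cauchy-schwarz x (L x) 0<q ⟩
        (x ∙ x) * (L x ∙ L x)   ≈⟨ *-congˡ (L-sym x (L x)) ⟩
        (x ∙ x) * (x ∙ L (L x)) ∎

  square-isPositiveSymmetric : ∀ {n} {x : Vector Carrier n} {L} →
    IsPositiveSymmetric x L → IsPositiveSymmetric x (L ∘ L)
  square-isPositiveSymmetric isPS = record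
    { L-cong = L-cong ∘ L-cong
    ; L-+    = λ v w i → trans (L-cong (L-+ v w) i) (L-+ _ _ i)
    ; L-*    = λ a v i → trans (L-cong (L-* a v) i) (L-* a _ i)
    ; L-sym  = λ v w → trans (L-sym _ w) (L-sym v _)
    ; L-pos  = L-pos ∘ L-pos
    ; L≤x*L  = L≤x*L ∘ L-pos
    }
    where open IsPositiveSymmetric isPS

  module _ {n} (A : Matrix n) (x : Vector Carrier n)
           (A-sym : ∀ i j → A i j ≈ A j i)
           (0≤A : ∀ i j → 0# ≤ A i j) (A≤x*A : ∀ i j → A i j ≤ x i * A i j) where

    apply : Vector Carrier n → Vector Carrier n
    apply v i = A i ∙ v

    apply-isPositiveSymmetric : IsPositiveSymmetric x apply
    apply-isPositiveSymmetric = record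
      { L-cong = λ v≈w i → ∙-cong {n} {A i} (λ _ → refl) v≈w
      ; L-+    = λ v w i → ∙-distribˡ-+ (A i) v w
      ; L-*    = λ a v i → ∙-*ˡ a (A i) v
      ; L-sym  = symmetric
      ; L-pos  = λ 0≤v i → ∙-nonneg (0≤A i) 0≤v
      ; L≤x*L  = λ {v} 0≤v i → begin
          A i ∙ v                             ≤⟨ ∑-mono-≤ (λ j → *-monoʳ-≤ (0≤v j) (A≤x*A i j)) ⟩
          (λ j → x i * A i j) ∙ v             ≈⟨ sum-cong-≋ {n} (λ j → *-assoc _ _ _) ⟩
          sum (λ j → x i * (A i j * v j))     ≈⟨ *-distribˡ-sum {n} (x i) _ ⟨
          x i * (A i ∙ v)                     ∎
      }
      where
      symmetric : ∀ v w → apply v ∙ w ≈ v ∙ apply w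
      symmetric v w = begin-equality
        sum (λ i → (A i ∙ v) * w i)
          ≈⟨ sum-cong-≋ {n} (λ i → trans (*-comm _ _) (*-distribˡ-sum {n} (w i) _)) ⟩
        sum (λ i → sum (λ j → w i * (A i j * v j)))
          ≈⟨ ∑-comm {n} {n} _ ⟩
        sum (λ j → sum (λ i → w i * (A i j * v j)))
          ≈⟨ sum-cong-≋ {n} (λ j → sum-cong-≋ {n} (λ i → trans
               (*-congˡ (*-congʳ (A-sym i j)))
               (solve 3 (λ w a v → w :* (a :* v) := v :* (a :* w)) refl (w i) (A j i) (v j)))) ⟩
        sum (λ j → sum (λ i → v j * (A j i * w i)))
          ≈⟨ sum-cong-≋ {n} (λ j → *-distribˡ-sum {n} (v j) _) ⟨
        v ∙ apply w ∎

    -- The power A^(2ᵏ).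
    L : ℕ → Vector Carrier n → Vector Carrier n
    L zero    = apply
    L (suc k) = L k ∘ L k

    L-isPositiveSymmetric : ∀ k → IsPositiveSymmetric x (L k)
    L-isPositiveSymmetric zero    = apply-isPositiveSymmetric
    L-isPositiveSymmetric (suc k) = square-isPositiveSymmetric (L-isPositiveSymmetric k)

    module LP k = IsPositiveSymmetric (L-isPositiveSymmetric k)

    module _ (0≤x : NonNegative x) where

      -- If κ u ≈ A u + x, then κ^N u ≈ A^N u + S for N = 2ᵏ and
      -- S = κ^(N-1) x + κ^(N-2) A x + … + A^(N-1) x. Already the terms of S with
      -- exponents 2ʲ make x ∙ S too large.
      module Resolvent (κ : Carrier) (0<κ : 0# < κ) (u : Vector Carrier n)
                       (κu≈Au+x : ∀ i → κ * u i ≈ A i ∙ u + x i) where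

        private p = κ ^2^_

        0≤p : ∀ k → 0# ≤ p k
        0≤p k = ^2^-nonneg k (<⇒≤ 0<κ)

        -- The recursion splits the sum of 2N terms into halves: the first carries an extra factor
        -- κ^N, the second an extra A^N.
        S : ℕ → Vector Carrier n
        S zero    i = x i
        S (suc k) i = p k * S k i + L k (S k) i

        S-nonneg : ∀ k → NonNegative (S k)
        S-nonneg zero      = 0≤x
        S-nonneg (suc k) i =
          +-nonneg (*-nonneg (0≤p k) (S-nonneg k i)) (LP.L-pos k (S-nonneg k) i)

        -- Multiply the equation for N by κ^N, move the scalar inside A^N, and use the same equation
        -- again there.
        pu≈Lu+S : ∀ k i → p k * u i ≈ L k u i + S k i
        pu≈Lu+S zero    = κu≈Au+x
        pu≈Lu+S (suc k) i = begin-equality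
          (p k * p k) * u i
            ≈⟨ *-assoc _ _ _ ⟩
          p k * (p k * u i)
            ≈⟨ *-congˡ (pu≈Lu+S k i) ⟩
          p k * (L k u i + S k i)
            ≈⟨ distribˡ _ _ _ ⟩
          p k * L k u i + p k * S k i
            ≈⟨ +-congʳ (L-* (p k) u i) ⟨
          L k (λ j → p k * u j) i + p k * S k i
            ≈⟨ +-congʳ (trans (L-cong (pu≈Lu+S k) i) (L-+ _ _ i)) ⟩
          (L k (L k u) i + L k (S k) i) + p k * S k i
            ≈⟨ trans (+-assoc _ _ _) (+-congˡ (+-comm _ _)) ⟩
          L k (L k u) i + (p k * S k i + L k (S k) i) ∎
          where open LP k

        -- `S k` contains the term κ^(N-1) x and the rest is nonnegative. The factor κ on the right
        -- replaces the exponent N - 1.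
        px≤κS : ∀ k i → p k * x i ≤ κ * S k i
        px≤κS zero    i = ≤-refl
        px≤κS (suc k) i = begin
          (p k * p k) * x i
            ≈⟨ *-assoc _ _ _ ⟩
          p k * (p k * x i)
            ≤⟨ *-monoˡ-≤ (0≤p k) (px≤κS k i) ⟩
          p k * (κ * S k i)
            ≤⟨ x≤x+y (*-nonneg (<⇒≤ 0<κ) (LP.L-pos k (S-nonneg k) i)) ⟩
          p k * (κ * S k i) + κ * L k (S k) i
            ≈⟨ solve 4 (λ p κ s l → p :* (κ :* s) :+ κ :* l := κ :* (p :* s :+ l))
                 refl (p k) κ (S k i) (L k (S k) i) ⟩
          κ * (p k * S k i + L k (S k) i) ∎

        module _ (p≤y : ∀ k → p k ≤ x ∙ L k x) where

          -- The gain from one doubling: of A^N `S k` only κ^(N-1) A^N x is kept, and x ∙ A^N x is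
          -- at least κ^N.
          p²≤κx∙LS : ∀ k → p k * p k ≤ κ * (x ∙ L k (S k))
          p²≤κx∙LS k = begin
            p k * p k                     ≤⟨ *-monoˡ-≤ (0≤p k) (p≤y k) ⟩
            p k * (x ∙ L k x)             ≈⟨ *-congˡ (∙-comm x (L k x)) ⟩
            p k * (L k x ∙ x)             ≈⟨ ∙-*ˡ (p k) (L k x) x ⟨
            L k x ∙ (λ i → p k * x i)     ≤⟨ ∙-monoˡ-≤ (LP.L-pos k 0≤x) (px≤κS k) ⟩
            L k x ∙ (λ i → κ * S k i)     ≈⟨ ∙-*ˡ κ (L k x) (S k) ⟩
            κ * (L k x ∙ S k)             ≈⟨ *-congˡ (LP.L-sym k x (S k)) ⟩
            κ * (x ∙ L k (S k))           ∎

          -- Each doubling multiplies the bound so far by `p k` and adds one more `p k * p k`, so k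
          -- doublings collect k copies of `p k`.
          kp≤κx∙S : ∀ k → fromℕ k * p k ≤ κ * (x ∙ S k)
          kp≤κx∙S zero    = begin
            0# * κ          ≈⟨ zeroˡ κ ⟩
            0#              ≤⟨ *-nonneg (<⇒≤ 0<κ) (∙-nonneg 0≤x 0≤x) ⟩
            κ * (x ∙ x)     ∎
          kp≤κx∙S (suc k) = begin
            (1# + fromℕ k) * (p k * p k)
              ≈⟨ solve 2 (λ j p → (con 1 :+ j) :* (p :* p) := p :* (j :* p) :+ p :* p)
                   refl (fromℕ k) (p k) ⟩
            p k * (fromℕ k * p k) + p k * p k
              ≤⟨ +-mono-≤ (*-monoˡ-≤ (0≤p k) (kp≤κx∙S k)) (p²≤κx∙LS k) ⟩
            p k * (κ * (x ∙ S k)) + κ * (x ∙ L k (S k))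
              ≈⟨ solve 4 (λ p κ s l → p :* (κ :* s) :+ κ :* l := κ :* (p :* s :+ l))
                   refl (p k) κ (x ∙ S k) (x ∙ L k (S k)) ⟩
            κ * (p k * (x ∙ S k) + x ∙ L k (S k))
              ≈⟨ *-congˡ (+-congʳ (∙-*ˡ (p k) x (S k))) ⟨
            κ * (x ∙ (λ i → p k * S k i) + x ∙ L k (S k))
              ≈⟨ *-congˡ (∙-distribˡ-+ x _ _) ⟨
            κ * (x ∙ S (suc k)) ∎

        -- A bound for every `- u i`, because 1 + uᵢ² + uᵢ is nonnegative.
        U : Carrier
        U = 1# + u ∙ u

        0≤U : 0# ≤ U
        0≤U = +-nonneg (<⇒≤ 0<1) (∑-nonneg λ i → x²-nonneg (u i))

        0≤U+u : ∀ i → 0# ≤ U + u i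
        0≤U+u i = ≤-trans (0≤1+x+x² (u i))
          (+-monoˡ-≤ (u i) (+-monoʳ-≤ 1# (v≤∑v (λ j → x²-nonneg (u j)) i)))

        -- This is x ∙ A^N u ≥ - U (x ∙ A^N x). Pair the nonnegative vector `L k x` with U + u, and
        -- use `L≤x*L` to turn the plain sum of its entries into a dot product with `x`.
        0≤Uy+x∙Lu : ∀ k → 0# ≤ U * (x ∙ L k x) + x ∙ L k u
        0≤Uy+x∙Lu k = begin
          0#
            ≤⟨ ∑-nonneg (λ i → begin
              0#
                ≤⟨ *-nonneg (0≤Lx i) (0≤U+u i) ⟩
              L k x i * (U + u i)
                ≈⟨ distribˡ _ _ _ ⟩
              L k x i * U + L k x i * u i
                ≤⟨ +-monoˡ-≤ _ (*-monoʳ-≤ 0≤U (LP.L≤x*L k 0≤x i)) ⟩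
              (x i * L k x i) * U + L k x i * u i
                ≈⟨ +-congʳ (*-comm _ _) ⟩
              U * (x i * L k x i) + L k x i * u i ∎) ⟩
          sum (λ i → U * (x i * L k x i) + L k x i * u i)
            ≈⟨ ∑-distrib-+ {n} _ _ ⟩
          sum (λ i → U * (x i * L k x i)) + L k x ∙ u
            ≈⟨ +-cong (sym (*-distribˡ-sum {n} U _)) (LP.L-sym k x u) ⟩
          U * (x ∙ L k x) + x ∙ L k u ∎
          where 0≤Lx = LP.L-pos k 0≤x

        -- By `pu≈Lu+S`, x ∙ S is κ^N (x ∙ u) - x ∙ A^N u, and both terms are at most a constant
        -- times κ^N. Adding the nonnegative quantity of `0≤Uy+x∙Lu` takes the place of the
        -- subtraction.
        x∙S≤Dp : ∀ k → x ∙ L k x ≤ (x ∙ x) * p k →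
                 x ∙ S k ≤ (U * (x ∙ x) + x ∙ u) * p k
        x∙S≤Dp k y≤qp = begin
          x ∙ S k
            ≤⟨ y≤x+y (0≤Uy+x∙Lu k) ⟩
          (U * (x ∙ L k x) + x ∙ L k u) + x ∙ S k
            ≈⟨ trans (+-assoc _ _ _) (+-congˡ (sym (∙-distribˡ-+ x _ _))) ⟩
          U * (x ∙ L k x) + x ∙ (λ i → L k u i + S k i)
            ≈⟨ +-congˡ (trans (∙-cong {n} {x} (λ _ → refl) (λ i → sym (pu≈Lu+S k i))) (∙-*ˡ (p k) x u)) ⟩
          U * (x ∙ L k x) + p k * (x ∙ u)
            ≤⟨ +-monoˡ-≤ _ (*-monoˡ-≤ 0≤U y≤qp) ⟩
          U * ((x ∙ x) * p k) + p k * (x ∙ u)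
            ≈⟨ solve 4 (λ U q p s → U :* (q :* p) :+ p :* s := (U :* q :+ s) :* p)
                 refl U (x ∙ x) (p k) (x ∙ u) ⟩
          (U * (x ∙ x) + x ∙ u) * p k ∎

        -- The lower and upper bounds on κ (x ∙ S) give k κ^N ≤ κ D κ^N for every k, which fails
        -- once k exceeds κ D.
        unbounded : ¬ (∀ k → p k ≤ x ∙ L k x × x ∙ L k x ≤ (x ∙ x) * p k)
        unbounded bounds with archimedean (κ * (U * (x ∙ x) + x ∙ u))
        ... | k , κD<k = <.irrefl refl (begin-strict
          p k * (κ * D)     <⟨ *-monoˡ-< (^2^-pos k 0<κ) κD<k ⟩
          p k * fromℕ k     ≈⟨ *-comm _ _ ⟩
          fromℕ k * p k     ≤⟨ kp≤κx∙S (λ j → proj₁ (bounds j)) k ⟩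
          κ * (x ∙ S k)     ≤⟨ *-monoˡ-≤ (<⇒≤ 0<κ) (x∙S≤Dp k (proj₂ (bounds k))) ⟩
          κ * (D * p k)     ≈⟨ solve 3 (λ κ D p → κ :* (D :* p) := p :* (κ :* D)) refl κ D (p k) ⟩
          p k * (κ * D)     ∎)
          where D = U * (x ∙ x) + x ∙ u

      rayleigh : 1# ≤ x ∙ x → 0# < x ∙ apply x →
                 ∀ {μ} → IsLargestEigenvalue A μ → x ∙ apply x ≤ (x ∙ x) * μ
      rayleigh 1≤q 0<y₀ {μ} (_ , largest) = conclude
        (growth-rate (λ k → x ∙ L k x) 1≤q 0<y₀
          (λ k → LP.x∙Lx-nonneg k 0≤x)
          (λ k → LP.x∙LLx≤[x∙Lx]² k 0≤x)
          (λ k → LP.[x∙Lx]²≤x∙x*x∙LLx k 0≤x (<-≤-trans 0<1 1≤q)))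
        where
        conclude : (∃[ κ ] 0# < κ × x ∙ apply x ≤ (x ∙ x) * κ ×
                     (∀ k → κ ^2^ k ≤ x ∙ L k x × x ∙ L k x ≤ (x ∙ x) * κ ^2^ k)) →
                   x ∙ apply x ≤ (x ∙ x) * μ
        conclude (κ , 0<κ , y₀≤qκ , bounds) =
          -- It remains to refute μ < κ. By maximality of μ it would make κ no eigenvalue, so the
          -- resolvent equation would be solvable up to double negation, which is enough for a
          -- contradiction.
          ≤-trans y₀≤qκ (*-monoˡ-≤ (≤-trans (<⇒≤ 0<1) 1≤q) λ μ<κ →
            fredholm A κ x (λ eigen → largest κ eigen μ<κ) λ (u , eq) →
              Resolvent.unbounded κ 0<κ u eq bounds)

-- Sums over lists, and Cauchy-Schwarz for reciprocal weights.

module ListSums {c ℓ₁ ℓ₂} (ℝ : RealNumbers c ℓ₁ ℓ₂) where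
  open RealNumbers ℝ
  open RealOperations ℝ
  open OrderedField ℝ
  open ≤-Reasoning
  open CommutativeRing commutativeRing using (commutativeSemiring)
  open SemiringSolver commutativeSemiring

  listSum : ∀ {a} {A : Set a} → (A → Carrier) → List A → Carrier
  listSum f = foldr (λ x s → f x + s) 0#

  listSum-mono-≤ : ∀ {a} {A : Set a} {f g : A → Carrier} → (∀ x → f x ≤ g x) →
                   ∀ xs → listSum f xs ≤ listSum g xs
  listSum-mono-≤ f≤g []       = ≤-refl
  listSum-mono-≤ f≤g (x ∷ xs) = +-mono-≤ (f≤g x) (listSum-mono-≤ f≤g xs)

  listSum-1 : ∀ {a} {A : Set a} (xs : List A) → listSum (λ _ → 1#) xs ≈ fromℕ (length xs)
  listSum-1 []       = refl
  listSum-1 (x ∷ xs) = +-congˡ (listSum-1 xs)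

  listSum-++ : ∀ {a} {A : Set a} (f : A → Carrier) xs ys →
               listSum f (xs ++ ys) ≈ listSum f xs + listSum f ys
  listSum-++ f []       ys = sym (+-identityˡ _)
  listSum-++ f (x ∷ xs) ys = trans (+-congˡ (listSum-++ f xs ys)) (sym (+-assoc _ _ _))

  listSum-map : ∀ {a b} {A : Set a} {B : Set b} (f : B → Carrier) (h : A → B) xs →
                listSum f (List.map h xs) ≈ listSum (f ∘ h) xs
  listSum-map f h []       = refl
  listSum-map f h (x ∷ xs) = +-congˡ (listSum-map f h xs)

  listSum-mapMaybe : ∀ {a b} {A : Set a} {B : Set b} (f : B → Carrier) (h : A → Maybe B) xs →
                     listSum f (mapMaybe h xs) ≈ listSum (maybe′ f 0# ∘ h) xs
  listSum-mapMaybe f h []       = refl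
  listSum-mapMaybe f h (x ∷ xs) with h x
  ... | just _  = +-congˡ (listSum-mapMaybe f h xs)
  ... | nothing = trans (listSum-mapMaybe f h xs) (sym (+-identityˡ _))

  listSum-filter : ∀ {a p} {A : Set a} {P : Pred A p} (P? : Decidable P) xs →
    fromℕ (length (filter P? xs)) ≈ listSum (λ x → if does (P? x) then 1# else 0#) xs
  listSum-filter P? []       = refl
  listSum-filter P? (x ∷ xs) with does (P? x)
  ... | true  = +-congˡ (listSum-filter P? xs)
  ... | false = trans (listSum-filter P? xs) (sym (+-identityˡ _))

  listSum-tabulate : ∀ {a n} {A : Set a} (f : A → Carrier) (h : Fin n → A) →
                     listSum f (tabulate h) ≈ sum (f ∘ h)
  listSum-tabulate {n = zero}  f h = refl
  listSum-tabulate {n = suc n} f h = +-congˡ (listSum-tabulate f (h ∘ Fin.suc))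

  listSum-cartesianProduct : ∀ {a b} {A : Set a} {B : Set b} (f : A × B → Carrier) xs ys →
    listSum f (cartesianProduct xs ys) ≈ listSum (λ x → listSum (λ y → f (x , y)) ys) xs
  listSum-cartesianProduct f []       ys = refl
  listSum-cartesianProduct f (x ∷ xs) ys = trans
    (listSum-++ f (List.map (x ,_) ys) _)
    (+-cong (listSum-map f (x ,_) ys) (listSum-cartesianProduct f xs ys))

  -- This is 2(a s) b ≤ (a s)² + b² multiplied by `r`, with s r = 1.
  2ab≤a²s+b²r : ∀ a b {s r} → 0# ≤ r → s * r ≈ 1# →
                a * b + a * b ≤ a * a * s + b * b * r
  2ab≤a²s+b²r a b {s} {r} 0≤r sr≈1 = begin
    a * b + a * b
      ≈⟨ solve 2 (λ a b → a :* b :+ a :* b := (a :* b :+ a :* b) :* con 1) refl a b ⟩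
    (a * b + a * b) * 1#
      ≈⟨ *-congˡ sr≈1 ⟨
    (a * b + a * b) * (s * r)
      ≈⟨ solve 4 (λ a b s r → (a :* b :+ a :* b) :* (s :* r)
                           := r :* (a :* s :* b :+ a :* s :* b)) refl a b s r ⟩
    r * (a * s * b + a * s * b)
      ≤⟨ *-monoˡ-≤ 0≤r (2xy≤x²+y² (a * s) b) ⟩
    r * (a * s * (a * s) + b * b)
      ≈⟨ solve 4 (λ a b s r → r :* (a :* s :* (a :* s) :+ b :* b)
                           := a :* a :* s :* (s :* r) :+ b :* b :* r) refl a b s r ⟩
    a * a * s * (s * r) + b * b * r
      ≈⟨ +-congʳ (trans (*-congˡ sr≈1) (*-identityʳ _)) ⟩
    a * a * s + b * b * r ∎

  module _ {a} {A : Set a} {s r : A → Carrier}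
           (0≤r : ∀ x → 0# ≤ r x) (sr≈1 : ∀ x → s x * r x ≈ 1#) where

    -- With `a` and `b` the same for all entries, the termwise bound is linear in the weights and
    -- can be summed.
    2ab∣xs∣≤a²∑s+b²∑r : ∀ a b xs → fromℕ (length xs) * (a * b + a * b) ≤
                        a * a * listSum s xs + b * b * listSum r xs
    2ab∣xs∣≤a²∑s+b²∑r a b []       = ≤-reflexive
      (solve 2 (λ a b → con 0 :* (a :* b :+ a :* b) := a :* a :* con 0 :+ b :* b :* con 0) refl a b)
    2ab∣xs∣≤a²∑s+b²∑r a b (x ∷ xs) = begin
      (1# + m) * (a * b + a * b)
        ≈⟨ trans (distribʳ _ 1# m) (+-congʳ (*-identityˡ _)) ⟩
      (a * b + a * b) + m * (a * b + a * b)
        ≤⟨ +-mono-≤ (2ab≤a²s+b²r a b (0≤r x) (sr≈1 x)) (2ab∣xs∣≤a²∑s+b²∑r a b xs) ⟩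
      (a * a * s x + b * b * r x) + (a * a * listSum s xs + b * b * listSum r xs)
        ≈⟨ solve 6 (λ a b s r S R → (a :* s :+ b :* r) :+ (a :* S :+ b :* R)
             := a :* (s :+ S) :+ b :* (r :+ R))
             refl (a * a) (b * b) (s x) (r x) (listSum s xs) (listSum r xs) ⟩
      a * a * (s x + listSum s xs) + b * b * (r x + listSum r xs) ∎
      where m = fromℕ (length xs)

    ∣xs∣²≤∑s*∑r : ∀ xs → 0# < listSum s xs →
      fromℕ (length xs) * fromℕ (length xs) ≤ listSum s xs * listSum r xs
    ∣xs∣²≤∑s*∑r xs 0<S = *-cancelˡ-≤ 0<S (+-cancelʳ-≤ (m * m * S) (begin
      S * (m * m) + m * m * S
        ≈⟨ solve 2 (λ m S → S :* (m :* m) :+ m :* m :* S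
                         := m :* (m :* S :+ m :* S)) refl m S ⟩
      m * (m * S + m * S)
        -- The choice a = m, b = S makes the left side 2 m² S, of which one half cancels against the
        -- first term on the right.
        ≤⟨ 2ab∣xs∣≤a²∑s+b²∑r m S xs ⟩
      m * m * S + S * S * R
        ≈⟨ trans (+-comm _ _) (+-congʳ (*-assoc S S R)) ⟩
      S * (S * R) + m * m * S ∎))
      where
      m = fromℕ (length xs)
      S = listSum s xs
      R = listSum r xs

-- Degrees, edge sums and the bounds for a graph.

module Graph {c ℓ₁ ℓ₂} (ℝ : RealNumbers c ℓ₁ ℓ₂) {n} (G : SimpleGraph n) where
  open RealNumbers ℝ
  open RealOperations ℝ
  open OrderedField ℝ
  open FiniteSums ℝ
  open ListSums ℝ
  open Spectral ℝ
  open SimpleGraph G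
  open GraphInvariants ℝ G
  open ≤-Reasoning
  open CommutativeRing commutativeRing using (commutativeSemiring)
  open SemiringSolver commutativeSemiring

  private A = adjacencyMatrix

  A-edge : ∀ {i j} → i ~ j → A i j ≈ 1#
  A-edge {i} {j} i~j with i ~? j
  ... | yes _   = refl
  ... | no  i≁j = ⊥-elim (i≁j i~j)

  A-nonedge : ∀ {i j} → ¬ i ~ j → A i j ≈ 0#
  A-nonedge {i} {j} i≁j with i ~? j
  ... | yes i~j = ⊥-elim (i≁j i~j)
  ... | no  _   = refl

  A-sym : ∀ i j → A i j ≈ A j i
  A-sym i j with i ~? j
  ... | yes i~j = sym (A-edge (~-sym i~j))
  ... | no  i≁j = sym (A-nonedge (i≁j ∘ ~-sym))

  0≤A : ∀ i j → 0# ≤ A i j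
  0≤A i j with does (i ~? j)
  ... | true  = <⇒≤ 0<1
  ... | false = ≤-refl

  fromℕ-deg : ∀ i → fromℕ (deg i) ≈ sum (A i)
  fromℕ-deg i = trans (listSum-filter (i ~?_) (allFin n)) (listSum-tabulate (A i) id)

  √ℕ-nonneg : ∀ k → 0# ≤ √ℕ k
  √ℕ-nonneg k = √-nonneg _ (fromℕ-nonneg k)

  √ℕ-square : ∀ k → √ℕ k * √ℕ k ≈ fromℕ k
  √ℕ-square k = √-square _ (fromℕ-nonneg k)

  -- Both sides are nonnegative and have the same square.
  √ℕ-* : ∀ j k → √ℕ (j ℕ.* k) ≈ √ℕ j * √ℕ k
  √ℕ-* j k = ≤-antisym
    (square-cancel-≤ 0≤√√ (≤-reflexive squares))
    (square-cancel-≤ (√ℕ-nonneg (j ℕ.* k)) (≤-reflexive (sym squares)))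
    where
    0≤√√ = *-nonneg (√ℕ-nonneg j) (√ℕ-nonneg k)
    squares : √ℕ (j ℕ.* k) * √ℕ (j ℕ.* k) ≈ (√ℕ j * √ℕ k) * (√ℕ j * √ℕ k)
    squares = begin-equality
      √ℕ (j ℕ.* k) * √ℕ (j ℕ.* k)       ≈⟨ √ℕ-square (j ℕ.* k) ⟩
      fromℕ (j ℕ.* k)                   ≈⟨ fromℕ-* j k ⟩
      fromℕ j * fromℕ k                 ≈⟨ *-cong (√ℕ-square j) (√ℕ-square k) ⟨
      (√ℕ j * √ℕ j) * (√ℕ k * √ℕ k)     ≈⟨ solve 2 (λ a b → (a :* a) :* (b :* b)
                                             := (a :* b) :* (a :* b)) refl (√ℕ j) (√ℕ k) ⟩
      (√ℕ j * √ℕ k) * (√ℕ j * √ℕ k)     ∎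

  1≤√ℕ : ∀ {k} → 0 ℕ.< k → 1# ≤ √ℕ k
  1≤√ℕ {k} 0<k = square-cancel-≤ (√ℕ-nonneg k) (begin
    1# * 1#     ≈⟨ *-identityˡ 1# ⟩
    1#          ≤⟨ 1≤fromℕ 0<k ⟩
    fromℕ k     ≈⟨ √ℕ-square k ⟨
    √ℕ k * √ℕ k ∎)

  √deg : Vector Carrier n
  √deg i = √ℕ (deg i)

  -- A nonzero entry gives `i` a neighbour, so its degree is at least 1. This is the support
  -- condition of the Rayleigh inequality, and isolated vertices satisfy it because their rows
  -- vanish.
  A≤√deg*A : ∀ i j → A i j ≤ √deg i * A i j
  A≤√deg*A i j with i ~? j
  ... | yes i~j = ≤-trans (1≤√ℕ (deg-pos i~j)) (≤-reflexive (sym (*-identityʳ _)))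
  ... | no  _   = ≤-reflexive (sym (zeroʳ _))

  module _ (f : Edge → Carrier) (g : Fin n → Fin n → Carrier)
           (f≈g : ∀ e → f e ≈ g (Edge.src e) (Edge.tgt e)) (g-sym : ∀ i j → g i j ≈ g j i) where

    private
      -- `f` as a strictly upper triangular matrix, zero away from the edges.
      w : Fin n → Fin n → Carrier
      w i j = maybe′ f 0# (toEdge (i , j))

    ∑E≈∑∑ : ∑E f ≈ sum (λ i → sum (λ j → w i j))
    ∑E≈∑∑ = begin-equality
      listSum f edges
        ≈⟨ listSum-mapMaybe f toEdge (cartesianProduct (allFin n) (allFin n)) ⟩
      listSum (maybe′ f 0# ∘ toEdge) (cartesianProduct (allFin n) (allFin n))
        ≈⟨ listSum-cartesianProduct (maybe′ f 0# ∘ toEdge) (allFin n) (allFin n) ⟩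
      listSum (λ i → listSum (w i) (allFin n)) (allFin n)
        ≈⟨ listSum-tabulate (λ i → listSum (w i) (allFin n)) id ⟩
      sum (λ i → listSum (w i) (allFin n))
        ≈⟨ sum-cong-≋ {n} (λ i → listSum-tabulate (w i) id) ⟩
      sum (λ i → sum (λ j → w i j)) ∎

    w-edge : ∀ {i j} → i Fin.< j → i ~ j → w i j ≈ g i j
    w-edge {i} {j} i<j i~j with (i Fin.<? j) ×-dec (i ~? j)
    ... | yes (i<j′ , i~j′) = f≈g (edge i<j′ i~j′)
    ... | no  ¬edge         = ⊥-elim (¬edge (i<j , i~j))

    w-nonedge : ∀ {i j} → ¬ (i Fin.< j × i ~ j) → w i j ≈ 0#
    w-nonedge {i} {j} ¬edge with (i Fin.<? j) ×-dec (i ~? j)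
    ... | yes e = ⊥-elim (¬edge e)
    ... | no  _ = refl

    -- For adjacent vertices exactly one of i < j and j < i holds, so exactly one summand carries
    -- the value.
    Ag≈w+w : ∀ i j → A i j * g i j ≈ w i j + w j i
    Ag≈w+w i j = split (i ~? j) (Fin.<-cmp i j)
      where
      split : Dec (i ~ j) → Tri (i Fin.< j) (i ≡ j) (j Fin.< i) →
              A i j * g i j ≈ w i j + w j i
      split (no i≁j) _ = trans (trans (*-congʳ (A-nonedge i≁j)) (zeroˡ _)) (sym (trans
        (+-cong (w-nonedge (i≁j ∘ proj₂)) (w-nonedge (i≁j ∘ ~-sym ∘ proj₂))) (+-identityˡ 0#)))
      split (yes i~j) (tri< i<j _ j≮i) =
        trans (trans (*-congʳ (A-edge i~j)) (*-identityˡ _)) (sym (trans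
          (+-cong (w-edge i<j i~j) (w-nonedge (j≮i ∘ proj₁))) (+-identityʳ _)))
      split (yes i~j) (tri≈ _ i≡j _)   = ⊥-elim (~-irrefl i≡j i~j)
      split (yes i~j) (tri> i≮j _ j<i) =
        trans (trans (*-congʳ (A-edge i~j)) (*-identityˡ _)) (sym (trans
          (+-cong (w-nonedge (i≮j ∘ proj₁)) (w-edge j<i (~-sym i~j)))
          (trans (+-identityˡ _) (g-sym j i))))

    -- Each edge is met from both ends; exchanging the order of summation identifies the sum of the
    -- transpose of `w` with that of `w`.
    handshake : sum (λ i → sum (λ j → A i j * g i j)) ≈ ∑E f + ∑E f
    handshake = begin-equality
      sum (λ i → sum (λ j → A i j * g i j))
        ≈⟨ sum-cong-≋ {n} (λ i → trans (sum-cong-≋ {n} (Ag≈w+w i)) (∑-distrib-+ {n} _ _)) ⟩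
      sum (λ i → sum (λ j → w i j) + sum (λ j → w j i))
        ≈⟨ ∑-distrib-+ {n} _ _ ⟩
      sum (λ i → sum (λ j → w i j)) + sum (λ i → sum (λ j → w j i))
        ≈⟨ +-congˡ (∑-comm {n} {n} (λ i j → w j i)) ⟩
      sum (λ i → sum (λ j → w i j)) + sum (λ j → sum (λ i → w j i))
        ≈⟨ +-cong ∑E≈∑∑ ∑E≈∑∑ ⟨
      ∑E f + ∑E f ∎

  private
    m = fromℕ ∣E∣
    S = ∑E (λ e → √ℕ (degProduct e))

  √deg∙√deg≈2m : √deg ∙ √deg ≈ m + m
  √deg∙√deg≈2m = begin-equality
    √deg ∙ √deg
      ≈⟨ sum-cong-≋ {n} (λ i → trans (√ℕ-square (deg i)) (fromℕ-deg i)) ⟩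
    sum (λ i → sum (A i))
      ≈⟨ sum-cong-≋ {n} (λ i → sum-cong-≋ {n} (λ j → sym (*-identityʳ (A i j)))) ⟩
    sum (λ i → sum (λ j → A i j * 1#))
      ≈⟨ handshake (λ _ → 1#) (λ _ _ → 1#) (λ _ → refl) (λ _ _ → refl) ⟩
    ∑E (λ _ → 1#) + ∑E (λ _ → 1#)
      ≈⟨ +-cong (listSum-1 edges) (listSum-1 edges) ⟩
    m + m ∎

  √deg∙A√deg≈2S : √deg ∙ (λ i → A i ∙ √deg) ≈ S + S
  √deg∙A√deg≈2S = begin-equality
    sum (λ i → √deg i * (A i ∙ √deg))
      ≈⟨ sum-cong-≋ {n} (λ i → trans (*-distribˡ-sum {n} (√deg i) _) (sum-cong-≋ {n} (λ j →
           solve 3 (λ x a y → x :* (a :* y) := a :* (x :* y)) refl (√deg i) (A i j) (√deg j)))) ⟩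
    sum (λ i → sum (λ j → A i j * (√deg i * √deg j)))
      ≈⟨ handshake (λ e → √ℕ (degProduct e)) (λ i j → √deg i * √deg j)
           (λ e → √ℕ-* (deg (Edge.src e)) (deg (Edge.tgt e))) (λ i j → *-comm _ _) ⟩
    S + S ∎

  -- Degree products of edges are at least 1; this supplies the positivity of `S`.
  m≤S : m ≤ S
  m≤S = begin
    m                       ≈⟨ listSum-1 edges ⟨
    listSum (λ _ → 1#) edges ≤⟨ listSum-mono-≤ (λ e → 1≤√ℕ (degProduct-pos e)) edges ⟩
    S                       ∎

  module _ (m≥1 : 1 ℕ.≤ ∣E∣) where

    0<m : 0# < m
    0<m = fromℕ-pos m≥1

    0<S : 0# < S
    0<S = <-≤-trans 0<m m≤S

    m²≤S*randić : m * m ≤ S * randić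
    m²≤S*randić = ∣xs∣²≤∑s*∑r
      (λ e → *-cancelˡ-≤ (0<√ e) (begin
        √ℕ (degProduct e) * 0#                 ≈⟨ zeroʳ _ ⟩
        0#                                     ≤⟨ <⇒≤ 0<1 ⟩
        1#                                     ≈⟨ √*1/√≈1 e ⟨
        √ℕ (degProduct e) * (1# / √ℕ (degProduct e) ⟨ _ ⟩) ∎))
      √*1/√≈1 edges 0<S
      where
      0<√ : ∀ e → 0# < √ℕ (degProduct e)
      0<√ e = <-≤-trans 0<1 (1≤√ℕ (degProduct-pos e))
      √*1/√≈1 : ∀ e → _
      √*1/√≈1 e = y*[x/y]≈x 1# (√ℕ (degProduct e)) (√ℕ-#0 (degProduct e) (degProduct-pos e))

    -- The inequality ε ≤ β cleared of denominators: the Rayleigh inequality for `√deg` reads 2S ≤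
    -- 2m μ.
    S≤mμ : ∀ {μ} → IsLargestEigenvalue A μ → S ≤ m * μ
    S≤mμ {μ} μ-largest = *-cancelˡ-≤ (<-≤-trans 0<1 (x≤x+y (<⇒≤ 0<1))) (begin
      (1# + 1#) * S
        ≈⟨ solve 1 (λ s → (con 1 :+ con 1) :* s := s :+ s) refl S ⟩
      S + S
        ≈⟨ √deg∙A√deg≈2S ⟨
      √deg ∙ (λ i → A i ∙ √deg)
        ≤⟨ rayleigh A √deg A-sym 0≤A A≤√deg*A (λ i → √ℕ-nonneg (deg i))
             1≤q 0<y₀ μ-largest ⟩
      (√deg ∙ √deg) * μ
        ≈⟨ *-congʳ √deg∙√deg≈2m ⟩
      (m + m) * μ
        ≈⟨ solve 2 (λ m μ → (m :+ m) :* μ := (con 1 :+ con 1) :* (m :* μ)) refl m μ ⟩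
      (1# + 1#) * (m * μ) ∎)
      where
      1≤q : 1# ≤ √deg ∙ √deg
      1≤q = begin
        1#            ≤⟨ 1≤fromℕ m≥1 ⟩
        m             ≤⟨ x≤x+y (<⇒≤ 0<m) ⟩
        m + m         ≈⟨ √deg∙√deg≈2m ⟨
        √deg ∙ √deg   ∎
      0<y₀ : 0# < √deg ∙ (λ i → A i ∙ √deg)
      0<y₀ = begin-strict
        0#                        <⟨ 0<S ⟩
        S                         ≤⟨ x≤x+y (<⇒≤ 0<S) ⟩
        S + S                     ≈⟨ √deg∙A√deg≈2S ⟨
        √deg ∙ (λ i → A i ∙ √deg) ∎

-- Assembling the chain of inequalities.

edge⇒0<n : ∀ {n} (G : SimpleGraph n) → 1 ℕ.≤ SimpleGraph.∣E∣ G → 0 ℕ.< n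
edge⇒0<n {zero}  G ()
edge⇒0<n {suc n} G _ = ℕ.z<s

mainTheorem7 :
    ∀ {c ℓ₁ ℓ₂} (ℝ : RealNumbers c ℓ₁ ℓ₂) (n : ℕ) (G : SimpleGraph n) →
    let open RealNumbers ℝ
        open RealOperations ℝ
        open SimpleGraph G
        open GraphInvariants ℝ G
    in
    (m≥1 : 1 ℕ.≤ ∣E∣) (μ : Carrier) →
    IsLargestEigenvalue adjacencyMatrix μ →
    Σ[ μ#0 ∈ μ # 0# ]
    Σ[ 2β#0 ∈ fromℕ 2 * β m≥1 μ # 0# ]
    Σ[ 2ε#0 ∈ fromℕ 2 * ε m≥1 # 0# ]
      ( fromℕ ∣E∣ / μ ⟨ μ#0 ⟩ ≈ fromℕ n / (fromℕ 2 * β m≥1 μ) ⟨ 2β#0 ⟩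
      × fromℕ n / (fromℕ 2 * β m≥1 μ) ⟨ 2β#0 ⟩ ≤ fromℕ n / (fromℕ 2 * ε m≥1) ⟨ 2ε#0 ⟩
      × fromℕ n / (fromℕ 2 * ε m≥1) ⟨ 2ε#0 ⟩ ≤ randić )
mainTheorem7 ℝ n G m≥1 μ μ-largest = μ#0 , 2β#0 , 2ε#0 , X≈Y , Y≤Z , Z≤randić
  where
  open RealNumbers ℝ
  open RealOperations ℝ
  open SimpleGraph G
  open GraphInvariants ℝ G
  open OrderedField ℝ
  open ≤-Reasoning
  open Graph ℝ G
  open CommutativeRing commutativeRing using (commutativeSemiring)
  open SemiringSolver commutativeSemiring

  m = fromℕ ∣E∣
  N = fromℕ n
  S = ∑E (λ e → √ℕ (degProduct e))
  b = fromℕ 2 * β m≥1 μ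
  e = fromℕ 2 * ε m≥1

  0<m₁ : 0# < m
  0<m₁ = 0<m m≥1

  0<S₁ : 0# < S
  0<S₁ = 0<S m≥1

  0<N : 0# < N
  0<N = fromℕ-pos (edge⇒0<n G m≥1)

  -- From 0 < S ≤ m μ. It makes every denominator in the statement apart from zero.
  0<μ : 0# < μ
  0<μ = *-pos-cancelˡ 0<m₁ (<-≤-trans 0<S₁ (S≤mμ m≥1 μ-largest))

  m*b≈μ*N : m * b ≈ μ * N
  m*b≈μ*N = begin-equality
    m * (fromℕ 2 * β m≥1 μ) ≈⟨ solve 3 (λ m t β → m :* (t :* β) := (t :* m) :* β)
                                 refl m (fromℕ 2) (β m≥1 μ) ⟩
    (fromℕ 2 * m) * β m≥1 μ ≈⟨ y*[x/y]≈x (μ * N) (fromℕ 2 * m) _ ⟩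
    μ * N                   ∎

  m²*e≈N*S : (m * m) * e ≈ N * S
  m²*e≈N*S = begin-equality
    (m * m) * (fromℕ 2 * ε m≥1) ≈⟨ solve 3 (λ m t ε → m :* (t :* ε) := (t :* m) :* ε)
                                     refl (m * m) (fromℕ 2) (ε m≥1) ⟩
    (fromℕ 2 * (m * m)) * ε m≥1 ≈⟨ y*[x/y]≈x (N * S) (fromℕ 2 * (m * m)) _ ⟩
    N * S                       ∎

  0<b : 0# < b
  0<b = *-pos-cancelˡ 0<m₁ (<.<-respʳ-≈ (sym m*b≈μ*N) (*-pos 0<μ 0<N))

  0<e : 0# < e
  0<e = *-pos-cancelˡ (*-pos 0<m₁ 0<m₁) (<.<-respʳ-≈ (sym m²*e≈N*S) (*-pos 0<N 0<S₁))

  μ#0  = #-sym (<⇒# 0<μ)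
  2β#0 = #-sym (<⇒# 0<b)
  2ε#0 = #-sym (<⇒# 0<e)

  X = m / μ ⟨ μ#0 ⟩
  Y = N / b ⟨ 2β#0 ⟩
  Z = N / e ⟨ 2ε#0 ⟩

  μX≈m : μ * X ≈ m
  μX≈m = y*[x/y]≈x m μ μ#0

  bY≈N : b * Y ≈ N
  bY≈N = y*[x/y]≈x N b 2β#0

  -- Thus n / (2ε) is m² / S, and both remaining inequalities can be checked after multiplying by
  -- `S`.
  SZ≈m² : S * Z ≈ m * m
  SZ≈m² = *-cancelˡ-≈ 0<N (begin-equality
    N * (S * Z)         ≈⟨ *-assoc N S Z ⟨
    (N * S) * Z         ≈⟨ *-congʳ m²*e≈N*S ⟨
    ((m * m) * e) * Z   ≈⟨ *-assoc (m * m) e Z ⟩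
    (m * m) * (e * Z)   ≈⟨ *-congˡ (y*[x/y]≈x N e 2ε#0) ⟩
    (m * m) * N         ≈⟨ *-comm (m * m) N ⟩
    N * (m * m)         ∎)

  X≈Y : X ≈ Y
  X≈Y = *-cancelˡ-≈ (*-pos 0<m₁ 0<b) (begin-equality
    (m * b) * X   ≈⟨ *-congʳ m*b≈μ*N ⟩
    (μ * N) * X   ≈⟨ solve 3 (λ μ N X → (μ :* N) :* X := (μ :* X) :* N) refl μ N X ⟩
    (μ * X) * N   ≈⟨ *-cong μX≈m (sym bY≈N) ⟩
    m * (b * Y)   ≈⟨ *-assoc m b Y ⟨
    (m * b) * Y   ∎)

  -- Multiplied by `S`, it follows from S (m / μ) ≤ m μ (m / μ) = m².
  Y≤Z : Y ≤ Z
  Y≤Z = *-cancelˡ-≤ 0<S₁ (begin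
    S * Y         ≈⟨ *-congˡ X≈Y ⟨
    S * X         ≤⟨ *-monoʳ-≤ 0≤X (S≤mμ m≥1 μ-largest) ⟩
    (m * μ) * X   ≈⟨ *-assoc m μ X ⟩
    m * (μ * X)   ≈⟨ *-congˡ μX≈m ⟩
    m * m         ≈⟨ SZ≈m² ⟨
    S * Z         ∎)
    where
    0≤X : 0# ≤ X
    0≤X = <⇒≤ (*-pos-cancelˡ 0<μ (<.<-respʳ-≈ (sym μX≈m) 0<m₁))

  Z≤randić : Z ≤ randić
  Z≤randić = *-cancelˡ-≤ 0<S₁ (begin
    S * Z       ≈⟨ SZ≈m² ⟩
    m * m       ≤⟨ m²≤S*randić m≥1 ⟩
    S * randić  ∎)
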